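{- Let $I,J\subseteq\mathbb{R}$ be open intervals, let $f:I\to J$ be an infinitely differentiable bijection whose inverse $y=f^{ -1}:J\to I$ is also infinitely differentiable, let $F^{\Delta}(n,m,x)$ ($x\in I$) be the composita of $f$, and let $Y^{\Delta}(n,m,x)$ ($x\in J$) be the composita of the inverse function $y$. Then the following recurrent expressions hold for all integers $n\ge m\ge 1$. (1) For all $x\in J$, $$Y^{\Delta}(n,m,x)=\begin{cases}\dfrac{1}{F^{\Delta}(m,m,y(x))}, & n=m,\\[2ex] -\dfrac{1}{F^{\Delta}(m,m,y(x))}\displaystyle\sum_{k=m+1}^{n}Y^{\Delta}(n,k,x)\,F^{\Delta}(k,m,y(x)), & n>m.\end{cases}$$ (2) For all $x\in I$, $$Y^{\Delta}(n,m,f(x))=\begin{cases}\dfrac{1}{F^{\Delta}(n,n,x)}, & n=m,\\[2ex] -\dfrac{1}{F^{\Delta}(n,n,x)}\displaystyle\sum_{k=m}^{n-1}F^{\Delta}(n,k,x)\,Y^{\Delta}(k,m,f(x)), & n>m.\end{cases}$$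
   Context: For an infinitely differentiable function $h$, the composita of $h$ means the composita of the generating function $h(x+z)-h(x)=\sum_{n\ge 1}\frac{h^{(n)}(x)}{n!}z^n$ (a formal power series in $z$), which is the array $$H^{\Delta}(n,k,x)=\sum_{\substack{\lambda_1+\cdots+\lambda_k=n\\ \lambda_1,\dots,\lambda_k\ge 1}}\frac{h^{(\lambda_1)}(x)}{\lambda_1!}\cdots\frac{h^{(\lambda_k)}(x)}{\lambda_k!},\qquad n\ge k\ge 1,$$ the sum being over all compositions of $n$ into exactly $k$ positive parts; equivalently, $[h(x+z)-h(x)]^k=\sum_{n\ge k}H^{\Delta}(n,k,x)z^n$. -}

module Defs where

open import Algebra.Apartness.Bundles using (HeytingCommutativeRing; HeytingField)
open import Algebra.Bundles using (CommutativeRing)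
import Algebra.Definitions.RawMonoid as RawMonoidDefinitions
open import Data.List.Base as List using (List; []; _∷_; applyUpTo; concatMap)
open import Data.Nat.Base as ℕ using (ℕ; zero; suc; _!)
open import Data.Nat.Properties using (_!≢0)
open import Data.Product.Base using (∃-syntax; _×_; proj₁)
open import Data.Sum.Base using (_⊎_; inj₂)
open import Data.Vec.Base as Vec using (Vec; []; _∷_)
open import Function.Base using (id)
open import Function.Bundles using (Func; Inverse; Equivalence; _⇔_; _⟨$⟩_)
import Function.Construct.Composition as Composition
open import Function.Properties.Inverse using (toFunction; fromFunction)
open import Level using (_⊔_) renaming (suc to lsuc)
open import Relation.Binary.Bundles using (Setoid)
open import Relation.Binary.Core using (Rel)
import Relation.Binary.Construct.Add.Extrema.Strict as AddExtrema
import Relation.Binary.Construct.On as On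
open import Relation.Binary.Structures using (IsStrictPartialOrder)
open import Relation.Nullary.Construct.Add.Extrema using (_±; [_])

infix 5 _⋯_

-- The integers a, a + 1, …, b (empty if b < a).
_⋯_ : ℕ → ℕ → List ℕ
a ⋯ b = applyUpTo (a ℕ.+_) (suc b ℕ.∸ a)

-- All (λ₁ , … , λₖ) with every λᵢ ≥ 1 and λ₁ + ⋯ + λₖ = n, each listed once.
compositions : (n k : ℕ) → List (Vec ℕ k)
compositions zero    zero    = [] ∷ []
compositions (suc _) zero    = []
compositions n       (suc k) = concatMap (λ l → List.map (l ∷_) (compositions (n ℕ.∸ l) k)) (1 ⋯ n)

-- The real numbers, as a Cauchy-complete Archimedean ordered field.
-- Classically ℝ is the only model up to isomorphism, with x # y meaning x ≠ y.
-- The axioms also hold of the Bishop reals, with x # y meaning x < y or y < x,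
-- so they are satisfiable without excluded middle.
record RealNumbers c ℓ₁ ℓ₂ : Set (lsuc (c ⊔ ℓ₁ ⊔ ℓ₂)) where
  infix 4 _<_ ∣_∣<_

  field
    heytingField : HeytingField c ℓ₁ ℓ₂

  open HeytingField heytingField public
  open HeytingCommutativeRing heytingCommutativeRing public using (commutativeRing)
  open CommutativeRing commutativeRing public using (+-rawMonoid)
  open RawMonoidDefinitions +-rawMonoid public using () renaming (_×_ to _·_)

  field
    _<_                  : Rel Carrier ℓ₂
    isStrictPartialOrder : IsStrictPartialOrder _≈_ _<_
    #⇔<⊎>                : ∀ {x y} → x # y ⇔ (x < y ⊎ y < x)
    0<1                  : 0# < 1#
    +-monoˡ-<            : ∀ {x y} z → x < y → x + z < y + z
    *-positive           : ∀ {x y} → 0# < x → 0# < y → 0# < x * y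

  ∣_∣<_ : Carrier → Carrier → Set ℓ₂
  ∣ x ∣< b = - b < x × x < b

  fromℕ : ℕ → Carrier
  fromℕ n = n · 1#

  IsCauchy : (ℕ → Carrier) → Set (c ⊔ ℓ₂)
  IsCauchy s = ∀ ε → 0# < ε → ∃[ N ] (∀ m n → N ℕ.≤ m → N ℕ.≤ n → ∣ s m - s n ∣< ε)

  _ConvergesTo_ : (ℕ → Carrier) → Carrier → Set (c ⊔ ℓ₂)
  s ConvergesTo l = ∀ ε → 0# < ε → ∃[ N ] (∀ n → N ℕ.≤ n → ∣ s n - l ∣< ε)

  field
    archimedean : ∀ x → ∃[ n ] x < fromℕ n
    complete    : ∀ s → IsCauchy s → ∃[ l ] s ConvergesTo l

module Calculus {c ℓ₁ ℓ₂} (ℝ : RealNumbers c ℓ₁ ℓ₂) where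
  open RealNumbers ℝ hiding (zero)
  open AddExtrema _<_ using (_<±_)

  infix 9 _⁻¹⟨_⟩
  infixr 5 ∑ ∏

  -- #⇒invertible inverts the difference x - 0#, which is ≈ x.
  _⁻¹⟨_⟩ : ∀ x → x # 0# → Carrier
  x ⁻¹⟨ x#0 ⟩ = proj₁ (#⇒invertible x#0)

  0<fromℕ : ∀ n .{{_ : ℕ.NonZero n}} → 0# < fromℕ n
  0<fromℕ (suc zero)    = <-respʳ-≈ (sym (+-identityʳ 1#)) 0<1
    where open IsStrictPartialOrder isStrictPartialOrder using (<-respʳ-≈)
  0<fromℕ (suc (suc n)) =
    <-trans (0<fromℕ (suc n)) (<-respˡ-≈ (+-identityˡ _) (+-monoˡ-< _ 0<1))
    where open IsStrictPartialOrder isStrictPartialOrder using (<-respˡ-≈) renaming (trans to <-trans)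

  n!#0 : ∀ n → fromℕ (n !) # 0#
  n!#0 n = Equivalence.from #⇔<⊎> (inj₂ (0<fromℕ (n !) {{n !≢0}}))

  ∑ : ∀ {a} {A : Set a} → List A → (A → Carrier) → Carrier
  ∑ xs t = List.foldr _+_ 0# (List.map t xs)

  syntax ∑ xs (λ i → t) = ∑[ i ← xs ] t

  ∏ : ∀ {a} {A : Set a} {k} → Vec A k → (A → Carrier) → Carrier
  ∏ xs t = Vec.foldr′ _*_ 1# (Vec.map t xs)

  syntax ∏ xs (λ i → t) = ∏[ i ← xs ] t

  -- Endpoints may be ±∞.
  record OpenInterval : Set c where
    constructor ⦅_,_⦆
    field
      lower upper : Carrier ±

  _∈_ : Carrier → OpenInterval → Set (c ⊔ ℓ₂)
  x ∈ ⦅ a , b ⦆ = a <± [ x ] × [ x ] <± b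

  Point : OpenInterval → Set (c ⊔ ℓ₂)
  Point I = ∃[ x ] x ∈ I

  Points : OpenInterval → Setoid (c ⊔ ℓ₂) ℓ₁
  Points I = On.setoid {B = Point I} setoid proj₁

  RealFunction : OpenInterval → Set (c ⊔ ℓ₁ ⊔ ℓ₂)
  RealFunction I = Func (Points I) setoid

  inclusion : ∀ I → RealFunction I
  inclusion I = record { to = proj₁ ; cong = id }

  -- (g t - g x) / (t - x) → L as t → x with t ≠ x in I.
  HasDerivativeAt : ∀ {I} → RealFunction I → Point I → Carrier → Set (c ⊔ ℓ₂)
  HasDerivativeAt {I} g x L =
    ∀ ε → 0# < ε → ∃[ δ ] 0# < δ ×
      (∀ (t : Point I) (t-x#0 : proj₁ t - proj₁ x # 0#) →
        ∣ proj₁ t - proj₁ x ∣< δ →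
        ∣ ((g ⟨$⟩ t) - (g ⟨$⟩ x)) * (proj₁ t - proj₁ x) ⁻¹⟨ t-x#0 ⟩ - L ∣< ε)

  -- Derivatives are unique up to ≈, so `deriv n` can only be the n-th derivative.
  record Smooth {I} (g : RealFunction I) : Set (c ⊔ ℓ₁ ⊔ ℓ₂) where
    field
      deriv      : ℕ → RealFunction I
      deriv-zero : ∀ x → deriv 0 ⟨$⟩ x ≈ g ⟨$⟩ x
      deriv-suc  : ∀ n x → HasDerivativeAt (deriv n) x (deriv (suc n) ⟨$⟩ x)

  -- The array h ↦ H^Δ(n, k, x) of a smooth function h.
  composita : ∀ {I} {h : RealFunction I} → Smooth h → (n k : ℕ) → Point I → Carrier
  composita h-smooth n k x =
    ∑[ λs ← compositions n k ] ∏[ l ← λs ] (deriv l ⟨$⟩ x) * fromℕ (l !) ⁻¹⟨ n!#0 l ⟩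
    where open Smooth h-smooth

  -- A bijection between I and J and its inverse, as real-valued functions.
  module _ {I J} (f : Inverse (Points I) (Points J)) where
    forward : RealFunction I
    forward = Composition.function (toFunction f) (inclusion J)

    backward : RealFunction J
    backward = Composition.function (fromFunction f) (inclusion I)

{-# OPTIONS --safe #-}
module Submission where

open import Defs
open import Algebra.Bundles using (CommutativeRing; RawRing)
import Algebra.Definitions.RawMonoid as RawMonoidDefinitions
open import Algebra.Solver.Ring.AlmostCommutativeRing
  using (fromCommutativeRing; _-Raw-AlmostCommutative⟶_)
open import Data.Empty using (⊥-elim)
open import Data.Integer.Base as ℤ using (ℤ; +_; -[1+_]; _⊖_; _◃_)
import Data.Integer.Properties as ℤ
open import Data.List.Base as List using (List; []; _∷_; _++_; applyUpTo; concatMap)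
open import Data.Maybe.Base using (Maybe; just; nothing)
open import Data.Nat.Base as ℕ using (ℕ; zero; suc; z≤n; s≤s)
import Data.Nat.Properties as ℕ
open import Data.Product.Base using (_×_; _,_; proj₁; proj₂; Σ-syntax; ∃-syntax)
import Data.Sign.Base as Sign
open import Data.Sum.Base using (_⊎_; inj₁; inj₂)
open import Data.Vec.Base using (Vec; _∷_)
open import Function.Base using (_∘_; case_of_)
open import Function.Bundles using (Equivalence; Func; Inverse; _⟨$⟩_)
open import Level using (Level; _⊔_)
import Relation.Binary.Construct.Add.Extrema.Strict as AddExtrema
open import Relation.Binary.PropositionalEquality.Core as ≡ using (_≡_)
open import Relation.Binary.Structures using (IsStrictPartialOrder)
open import Relation.Nullary.Construct.Add.Extrema using (⊤±) renaming ([_] to [_]ᵉ)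
open import Relation.Nullary.Decidable.Core using (yes; no)
open import Relation.Nullary.Negation.Core using (¬_)

-- Both recurrences are the entries of the two products of the triangular matrices
-- FΔ(x) and YΔ(f(x)) being the identity matrix, so it is enough to show that
--   E(n, m) = Σₖ FΔ(n, k, x) YΔ(k, m, f(x))
-- is the Kronecker delta (and the same with f and y exchanged). For the Taylor series
-- φ(x, z) = f(x + z) - f(x) one has ∂φ/∂x = ∂φ/∂z - f′(x), hence
--   ∂/∂x FΔ(n, k, x) = (n + 1) FΔ(n + 1, k, x) - k f′(x) FΔ(n, k - 1, x),
-- and likewise for YΔ. Differentiating E(n, m) with the product and chain rules, and
-- using y′(f(x)) f′(x) = 1, gives ∂/∂x E(n, m) = (n + 1) E(n + 1, m) - m E(n, m - 1);
-- by induction on n the left-hand side is 0. No Taylor remainder estimate is involved.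

-- Cancelling terms needs coefficients with decidable equality, hence ℤ.
module IntegerCoefficients {c ℓ} (R : CommutativeRing c ℓ) where
  open CommutativeRing R
  open import Algebra.Properties.Ring ring
    using (-0#≈0#; -‿distribˡ-*; -‿distribʳ-*; -‿involutive; -‿+-comm)
  open import Algebra.Properties.Semiring.Mult.TCOptimised semiring
    using (×-homo-+; ×1-homo-*; 1+×) renaming (_×_ to _·_)
  open import Algebra.Properties.CommutativeSemigroup
    (CommutativeRing.+-commutativeSemigroup R) using (interchange)
  open import Relation.Binary.Reasoning.Setoid setoid

  -- The canonical homomorphism from ℤ to a commutative ring.

  ⟦_⟧ℤ : ℤ → Carrier
  ⟦ + n ⟧ℤ      = n · 1#
  ⟦ -[1+ n ] ⟧ℤ = - (suc n · 1#)

  ⟦⊖⟧ : ∀ m n → ⟦ m ⊖ n ⟧ℤ ≈ m · 1# - n · 1#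
  ⟦⊖⟧ m       zero    = sym (trans (+-congˡ -0#≈0#) (+-identityʳ _))
  ⟦⊖⟧ zero    (suc n) = sym (+-identityˡ _)
  ⟦⊖⟧ (suc m) (suc n) = begin
    ⟦ suc m ⊖ suc n ⟧ℤ                 ≡⟨ ≡.cong ⟦_⟧ℤ (ℤ.[1+m]⊖[1+n]≡m⊖n m n) ⟩
    ⟦ m ⊖ n ⟧ℤ                         ≈⟨ ⟦⊖⟧ m n ⟩
    m · 1# - n · 1#                    ≈⟨ +-identityˡ _ ⟨
    0# + (m · 1# - n · 1#)             ≈⟨ +-congʳ (-‿inverseʳ 1#) ⟨
    (1# - 1#) + (m · 1# - n · 1#)      ≈⟨ interchange _ _ _ _ ⟩
    (1# + m · 1#) + (- 1# - n · 1#)    ≈⟨ +-cong (sym (1+× m 1#)) (-‿+-comm _ _) ⟩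
    suc m · 1# - (1# + n · 1#)         ≈⟨ +-congˡ (-‿cong (1+× n 1#)) ⟨
    suc m · 1# - suc n · 1#            ∎

  ⟦-◃⟧ : ∀ n → ⟦ Sign.- ◃ n ⟧ℤ ≈ - (n · 1#)
  ⟦-◃⟧ zero    = sym -0#≈0#
  ⟦-◃⟧ (suc n) = refl

  ⟦+⟧ : ∀ i j → ⟦ i ℤ.+ j ⟧ℤ ≈ ⟦ i ⟧ℤ + ⟦ j ⟧ℤ
  ⟦+⟧ (+ m)    (+ n)    = ×-homo-+ 1# m n
  ⟦+⟧ (+ m)    -[1+ n ] = ⟦⊖⟧ m (suc n)
  ⟦+⟧ -[1+ m ] (+ n)    = trans (⟦⊖⟧ n (suc m)) (+-comm _ _)
  ⟦+⟧ -[1+ m ] -[1+ n ] = begin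
    - (suc (suc (m ℕ.+ n)) · 1#)      ≡⟨ ≡.cong (λ k → - (suc k · 1#)) (ℕ.+-suc m n) ⟨
    - ((suc m ℕ.+ suc n) · 1#)        ≈⟨ -‿cong (×-homo-+ 1# (suc m) (suc n)) ⟩
    - (suc m · 1# + suc n · 1#)       ≈⟨ -‿+-comm _ _ ⟨
    - (suc m · 1#) - suc n · 1#       ∎

  ⟦*⟧ : ∀ i j → ⟦ i ℤ.* j ⟧ℤ ≈ ⟦ i ⟧ℤ * ⟦ j ⟧ℤ
  ⟦*⟧ (+ m) (+ n) = begin
    ⟦ Sign.+ ◃ (m ℕ.* n) ⟧ℤ ≡⟨ ≡.cong ⟦_⟧ℤ (ℤ.+◃n≡+n (m ℕ.* n)) ⟩
    (m ℕ.* n) · 1#          ≈⟨ ×1-homo-* m n ⟩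
    m · 1# * (n · 1#)       ∎
  ⟦*⟧ (+ m) -[1+ n ] = begin
    ⟦ Sign.- ◃ (m ℕ.* suc n) ⟧ℤ ≈⟨ ⟦-◃⟧ (m ℕ.* suc n) ⟩
    - ((m ℕ.* suc n) · 1#)      ≈⟨ -‿cong (×1-homo-* m (suc n)) ⟩
    - (m · 1# * (suc n · 1#))   ≈⟨ -‿distribʳ-* _ _ ⟩
    m · 1# * - (suc n · 1#)     ∎
  ⟦*⟧ -[1+ m ] (+ n) = begin
    ⟦ Sign.- ◃ (suc m ℕ.* n) ⟧ℤ ≈⟨ ⟦-◃⟧ (suc m ℕ.* n) ⟩
    - ((suc m ℕ.* n) · 1#)      ≈⟨ -‿cong (×1-homo-* (suc m) n) ⟩
    - (suc m · 1# * (n · 1#))   ≈⟨ -‿distribˡ-* _ _ ⟩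
    - (suc m · 1#) * (n · 1#)   ∎
  ⟦*⟧ -[1+ m ] -[1+ n ] = begin
    (suc m ℕ.* suc n) · 1#          ≈⟨ ×1-homo-* (suc m) (suc n) ⟩
    suc m · 1# * (suc n · 1#)       ≈⟨ -‿involutive _ ⟨
    - - (suc m · 1# * (suc n · 1#)) ≈⟨ -‿cong (-‿distribˡ-* _ _) ⟩
    - (- (suc m · 1#) * (suc n · 1#)) ≈⟨ -‿distribʳ-* _ _ ⟩
    - (suc m · 1#) * - (suc n · 1#) ∎

  ⟦-⟧ : ∀ i → ⟦ ℤ.- i ⟧ℤ ≈ - ⟦ i ⟧ℤ
  ⟦-⟧ (+ zero)  = sym -0#≈0#
  ⟦-⟧ (+ suc n) = refl
  ⟦-⟧ -[1+ n ]  = sym (-‿involutive _)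

  ℤ-rawRing : RawRing _ _
  ℤ-rawRing = record
    { _≈_ = _≡_ ; _+_ = ℤ._+_ ; _*_ = ℤ._*_ ; -_ = ℤ.-_ ; 0# = ℤ.0ℤ ; 1# = ℤ.1ℤ }

  homomorphism : ℤ-rawRing -Raw-AlmostCommutative⟶ fromCommutativeRing R
  homomorphism = record
    { ⟦_⟧    = ⟦_⟧ℤ
    ; +-homo = ⟦+⟧
    ; *-homo = ⟦*⟧
    ; -‿homo = ⟦-⟧
    ; 0-homo = refl
    -- The optimised multiple `_·_` has `1 · 1#` equal to `1#` by definition.
    ; 1-homo = refl
    }

  _coeff≟_ : ∀ i j → Maybe (⟦ i ⟧ℤ ≈ ⟦ j ⟧ℤ)
  i coeff≟ j with i ℤ.≟ j
  ... | yes ≡.refl = just refl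
  ... | no  _      = nothing

  open import Algebra.Solver.Ring ℤ-rawRing (fromCommutativeRing R) homomorphism _coeff≟_ public
    using (solve; _:=_; _:+_; _:*_; _:-_; :-_; con)

module PowerSeries {c ℓ} (R : CommutativeRing c ℓ) where
  open CommutativeRing R hiding (zero)
  open RawMonoidDefinitions +-rawMonoid using () renaming (_×_ to _·_)
  open IntegerCoefficients R using (solve; _:=_; _:+_; _:*_; _:-_; :-_; con)
  open import Relation.Binary.Reasoning.Setoid setoid

  infixl 7 _⊛_
  infix 4 _≋_

  -- Formal power series.

  Series : Set c
  Series = ℕ → Carrier

  _≋_ : Series → Series → Set ℓ
  α ≋ β = ∀ i → α i ≈ β i

  -- The unoptimised multiple: `nat (suc n)` unfolds to `1# + nat n`, which solver equations write
  -- as `con (+ 1) :+ n`.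
  nat : ℕ → Carrier
  nat n = n · 1#

  -- The Cauchy product, in the form α β = α₀ β + z (tail α) β; proofs go by induction on the index
  -- with the left factor shifted.
  _⊛_ : Series → Series → Series
  (α ⊛ β) zero    = α 0 * β 0
  (α ⊛ β) (suc n) = α 0 * β (suc n) + ((α ∘ suc) ⊛ β) n

  𝟏 : Series
  𝟏 zero    = 1#
  𝟏 (suc _) = 0#

  ∂ : Series → Series
  ∂ α n = nat (suc n) * α (suc n)

  power : Series → ℕ → Series
  power φ zero    = 𝟏
  power φ (suc k) = φ ⊛ power φ k

  -- Finite sums.

  sum : ℕ → Series → Carrier
  sum zero    α = 0#
  sum (suc n) α = sum n α + α n

  sum-cong : ∀ n {α β} → α ≋ β → sum n α ≈ sum n β
  sum-cong zero    e = refl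
  sum-cong (suc n) e = +-cong (sum-cong n e) (e n)

  sum-zero : ∀ n {α} → (∀ i → i ℕ.< n → α i ≈ 0#) → sum n α ≈ 0#
  sum-zero zero    e = refl
  sum-zero (suc n) e =
    trans (+-cong (sum-zero n (λ i i<n → e i (ℕ.m<n⇒m<1+n i<n))) (e n ℕ.≤-refl)) (+-identityˡ 0#)

  sum-suc : ∀ n α → sum (suc n) α ≈ α 0 + sum n (α ∘ suc)
  sum-suc zero    α = +-comm _ _
  sum-suc (suc n) α = trans (+-congʳ (sum-suc n α)) (+-assoc _ _ _)

  sum-+ : ∀ m n α → sum (m ℕ.+ n) α ≈ sum m α + sum n (α ∘ (m ℕ.+_))
  sum-+ zero    n α = sym (+-identityˡ _)
  sum-+ (suc m) n α = begin
    sum (suc m ℕ.+ n) α                              ≈⟨ sum-suc (m ℕ.+ n) α ⟩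
    α 0 + sum (m ℕ.+ n) (α ∘ suc)                    ≈⟨ +-congˡ (sum-+ m n (α ∘ suc)) ⟩
    α 0 + (sum m (α ∘ suc) + sum n (α ∘ (suc m ℕ.+_))) ≈⟨ +-assoc _ _ _ ⟨
    (α 0 + sum m (α ∘ suc)) + sum n (α ∘ (suc m ℕ.+_)) ≈⟨ +-congʳ (sum-suc m α) ⟨
    sum (suc m) α + sum n (α ∘ (suc m ℕ.+_))         ∎

  -- Algebra of the Cauchy product.

  ⊛-sum : ∀ α β n → (α ⊛ β) n ≈ sum (suc n) (λ i → α i * β (n ℕ.∸ i))
  ⊛-sum α β zero    = sym (+-identityˡ _)
  ⊛-sum α β (suc n) = trans (+-congˡ (⊛-sum (α ∘ suc) β n))
    (sym (sum-suc (suc n) (λ i → α i * β (suc n ℕ.∸ i))))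

  ⊛-cong : ∀ {α α′ β β′} → α ≋ α′ → β ≋ β′ → α ⊛ β ≋ α′ ⊛ β′
  ⊛-cong e e′ zero    = *-cong (e 0) (e′ 0)
  ⊛-cong e e′ (suc n) = +-cong (*-cong (e 0) (e′ (suc n))) (⊛-cong (e ∘ suc) e′ n)

  -- The combination β - a γ is the shape of ∂φ/∂z - f′(x) and of `shiftDerivative`.
  ⊛-distribˡ-linear : ∀ a α β γ n → (α ⊛ (λ i → β i - a * γ i)) n ≈ (α ⊛ β) n - a * (α ⊛ γ) n
  ⊛-distribˡ-linear a α β γ zero    =
    solve 4 (λ a x y z → x :* (y :- a :* z) := x :* y :- a :* (x :* z)) refl a (α 0) (β 0) (γ 0)
  ⊛-distribˡ-linear a α β γ (suc n) = trans (+-congˡ (⊛-distribˡ-linear a (α ∘ suc) β γ n))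
    (solve 6 (λ a x y z u v → x :* (y :- a :* z) :+ (u :- a :* v) := (x :* y :+ u) :- a :* (x :* z :+ v))
      refl a (α 0) (β (suc n)) (γ (suc n)) _ _)

  ⊛-distribʳ-linear : ∀ a α β γ n → ((λ i → α i - a * β i) ⊛ γ) n ≈ (α ⊛ γ) n - a * (β ⊛ γ) n
  ⊛-distribʳ-linear a α β γ zero    =
    solve 4 (λ a x y z → (x :- a :* y) :* z := x :* z :- a :* (y :* z)) refl a (α 0) (β 0) (γ 0)
  ⊛-distribʳ-linear a α β γ (suc n) = trans (+-congˡ (⊛-distribʳ-linear a (α ∘ suc) (β ∘ suc) γ n))
    (solve 6 (λ a x y z u v → (x :- a :* y) :* z :+ (u :- a :* v) := (x :* z :+ u) :- a :* (y :* z :+ v))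
      refl a (α 0) (β 0) (γ (suc n)) _ _)

  ⊛-zeroˡ : ∀ β n → ((λ _ → 0#) ⊛ β) n ≈ 0#
  ⊛-zeroˡ β zero    = zeroˡ _
  ⊛-zeroˡ β (suc n) = trans (+-cong (zeroˡ _) (⊛-zeroˡ β n)) (+-identityˡ 0#)

  ⊛-identityˡ : ∀ β → 𝟏 ⊛ β ≋ β
  ⊛-identityˡ β zero    = *-identityˡ _
  ⊛-identityˡ β (suc n) = trans (+-cong (*-identityˡ _) (⊛-zeroˡ β n)) (+-identityʳ _)

  ⊛-vanish : ∀ α β n → (∀ i → i ℕ.≤ n → β i ≈ 0#) → (α ⊛ β) n ≈ 0#
  ⊛-vanish α β zero    e = trans (*-congˡ (e 0 z≤n)) (zeroʳ _)
  ⊛-vanish α β (suc n) e = trans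
    (+-cong (trans (*-congˡ (e (suc n) ℕ.≤-refl)) (zeroʳ _))
            (⊛-vanish (α ∘ suc) β n (λ i i≤n → e i (ℕ.m≤n⇒m≤1+n i≤n))))
    (+-identityˡ 0#)

  ⊛-suc : ∀ α β n → (α ⊛ β) (suc n) ≈ (α ⊛ (β ∘ suc)) n + α (suc n) * β 0
  ⊛-suc α β zero    = refl
  ⊛-suc α β (suc n) = trans (+-congˡ (⊛-suc (α ∘ suc) β n)) (sym (+-assoc _ _ _))

  -- Leibniz rules for z d/dz and d/dz.

  θ : Series → Series
  θ α n = nat n * α n

  -- The operator z d/dz preserves degrees, so its Leibniz rule can be proved by induction along the
  -- recursion of `⊛`.
  θ-⊛ : ∀ α β n → θ (α ⊛ β) n ≈ (θ α ⊛ β) n + (α ⊛ θ β) n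
  θ-⊛ α β zero    =
    solve 2 (λ x y → con (+ 0) :* (x :* y) := con (+ 0) :* x :* y :+ x :* (con (+ 0) :* y)) refl (α 0) (β 0)
  θ-⊛ α β (suc n) = begin
    nat (suc n) * (a * b + s)
      ≈⟨ solve 4 (λ n a b s → (con (+ 1) :+ n) :* (a :* b :+ s) :=
           a :* ((con (+ 1) :+ n) :* b) :+ (s :+ n :* s)) refl (nat n) a b s ⟩
    a * (nat (suc n) * b) + (s + nat n * s)
      ≈⟨ +-congˡ (+-congˡ (θ-⊛ (α ∘ suc) β n)) ⟩
    a * (nat (suc n) * b) + (s + (p + q))
      ≈⟨ solve 6 (λ w a b s p q → a :* (w :* b) :+ (s :+ (p :+ q)) :=
           (con (+ 0) :* a :* b :+ (p :- (:- con (+ 1)) :* s)) :+ (a :* (w :* b) :+ q))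
         refl (nat (suc n)) a b s p q ⟩
    (nat 0 * a * b + (p - (- 1#) * s)) + (a * (nat (suc n) * b) + q)
      -- The tail of `θ α` is `θ (α ∘ suc)` plus `α ∘ suc`; the coefficient `- 1#` turns the
      -- difference of the linearity lemma into this sum.
      ≈⟨ +-congʳ (+-congˡ (⊛-distribʳ-linear (- 1#) (θ (α ∘ suc)) (α ∘ suc) β n)) ⟨
    (nat 0 * a * b + ((λ i → θ (α ∘ suc) i - (- 1#) * α (suc i)) ⊛ β) n) + (a * (nat (suc n) * b) + q)
      ≈⟨ +-congʳ (+-congˡ (⊛-cong {β = β} (λ i → solve 2 (λ n x →
           n :* x :- (:- con (+ 1)) :* x := (con (+ 1) :+ n) :* x) refl (nat i) (α (suc i))) (λ _ → refl) n)) ⟩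
    (θ α ⊛ β) (suc n) + (α ⊛ θ β) (suc n) ∎
    where
    a = α 0
    b = β (suc n)
    s = ((α ∘ suc) ⊛ β) n
    p = (θ (α ∘ suc) ⊛ β) n
    q = ((α ∘ suc) ⊛ θ β) n

  -- `∂ α` is the tail of `θ α`, so this is the rule for `θ` at index n + 1; the terms at index 0
  -- carry the factor `nat 0`.
  ∂-⊛ : ∀ α β n → ∂ (α ⊛ β) n ≈ (∂ α ⊛ β) n + (α ⊛ ∂ β) n
  ∂-⊛ α β n = begin
    θ (α ⊛ β) (suc n)                      ≈⟨ θ-⊛ α β (suc n) ⟩
    (θ α ⊛ β) (suc n) + (α ⊛ θ β) (suc n)  ≈⟨ +-congˡ (⊛-suc α (θ β) n) ⟩
    (nat 0 * α 0 * β (suc n) + (∂ α ⊛ β) n) + ((α ⊛ ∂ β) n + α (suc n) * (nat 0 * β 0))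
      ≈⟨ solve 6 (λ a b a′ b′ p q → (con (+ 0) :* a :* b :+ p) :+ (q :+ a′ :* (con (+ 0) :* b′)) := p :+ q)
           refl (α 0) (β (suc n)) (α (suc n)) (β 0) _ _ ⟩
    (∂ α ⊛ β) n + (α ⊛ ∂ β) n              ∎

  -- Powers of a series and their derivative in the base point.

  power-vanish : ∀ {φ} → φ 0 ≈ 0# → ∀ k n → n ℕ.< k → power φ k n ≈ 0#
  power-vanish φ₀ (suc k) zero    _         = trans (*-congʳ φ₀) (zeroˡ _)
  power-vanish φ₀ (suc k) (suc n) (s≤s n<k) = trans
    (+-cong (trans (*-congʳ φ₀) (zeroˡ _))
            (⊛-vanish _ _ n (λ i i≤n → power-vanish φ₀ k i (ℕ.≤-<-trans i≤n n<k))))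
    (+-identityˡ 0#)

  -- ∂(φᵏ)/∂x = ∂(φᵏ)/∂z - k h′(x) φᵏ⁻¹ for φ(x, z) = h(x + z) - h(x).
  shiftDerivative : Series → ℕ → Series
  shiftDerivative φ k n = ∂ (power φ k) n - nat k * (φ 1 * power φ (ℕ.pred k) n)

  shiftDerivative-base : ∀ φ n → 0# ≈ shiftDerivative φ 0 n
  shiftDerivative-base φ n =
    solve 3 (λ w c p → con (+ 0) := w :* con (+ 0) :- con (+ 0) :* (c :* p)) refl (nat (suc n)) (φ 1) (𝟏 n)

  -- The left side is the product rule in x for φ φᵏ. Its z-derivatives recombine by `∂-⊛`, and the
  -- multiples of φ₁ φᵏ add up to k + 1 of them.
  shiftDerivative-step : ∀ φ k n →
    ((λ i → ∂ φ i - φ 1 * 𝟏 i) ⊛ power φ k) n + (φ ⊛ shiftDerivative φ k) n ≈ shiftDerivative φ (suc k) n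
  shiftDerivative-step φ k n = begin
    ((λ i → ∂ φ i - φ′ * 𝟏 i) ⊛ power φ k) n + (φ ⊛ shiftDerivative φ k) n
      ≈⟨ +-cong (⊛-distribʳ-linear φ′ (∂ φ) 𝟏 (power φ k) n)
                (⊛-cong {α = φ} (λ _ → refl) (λ i → +-congˡ (-‿cong (sym (*-assoc _ _ _)))) n) ⟩
    (p - φ′ * (𝟏 ⊛ power φ k) n) + (φ ⊛ (λ i → ∂ (power φ k) i - nat k * φ′ * power φ (ℕ.pred k) i)) n
      ≈⟨ +-cong (+-congˡ (-‿cong (*-congˡ (⊛-identityˡ (power φ k) n))))
                (⊛-distribˡ-linear (nat k * φ′) φ (∂ (power φ k)) (power φ (ℕ.pred k)) n) ⟩
    (p - φ′ * power φ k n) + (q - nat k * φ′ * (φ ⊛ power φ (ℕ.pred k)) n)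
      ≈⟨ +-congˡ (+-congˡ (-‿cong (lower k))) ⟩
    (p - φ′ * power φ k n) + (q - nat k * φ′ * power φ k n)
      ≈⟨ solve 5 (λ p q w c r → (p :- c :* r) :+ (q :- w :* c :* r) :=
           (p :+ q) :- (con (+ 1) :+ w) :* (c :* r)) refl p q (nat k) φ′ (power φ k n) ⟩
    (p + q) - nat (suc k) * (φ′ * power φ k n)
      ≈⟨ +-congʳ (∂-⊛ φ (power φ k) n) ⟨
    shiftDerivative φ (suc k) n ∎
    where
    φ′ = φ 1
    p = (∂ φ ⊛ power φ k) n
    q = (φ ⊛ ∂ (power φ k)) n

    -- For k = 0 the default `pred 0 = 0` breaks φ φᵏ⁻¹ = φᵏ, but both sides carry the factor
    -- `nat 0`.
    lower : ∀ k → nat k * φ′ * (φ ⊛ power φ (ℕ.pred k)) n ≈ nat k * φ′ * power φ k n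
    lower zero    = solve 3 (λ c u v → con (+ 0) :* c :* u := con (+ 0) :* c :* v) refl φ′ _ _
    lower (suc k) = refl

  -- Composition of series.

  -- The coefficient of zⁿ in (ψ ∘ φ)ᵐ, truncated to the first N powers of φ.
  compositionCoefficient : Series → Series → ℕ → ℕ → ℕ → Carrier
  compositionCoefficient φ ψ N n m = sum N (λ k → power φ k n * power ψ m k)

  -- The terms -k φ 1 from φᵏ and (k + 1) φ 1 from ψᵐ telescope; the remaining boundary
  -- term vanishes as soon as n < N - 1.
  compositionCoefficient-derivative : ∀ φ ψ N n m →
    sum N (λ k → shiftDerivative φ k n * power ψ m k + power φ k n * (shiftDerivative ψ m k * φ 1)) ≈
    nat (suc n) * compositionCoefficient φ ψ N (suc n) m
      - nat m * (ψ 1 * φ 1 * compositionCoefficient φ ψ N n (ℕ.pred m))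
      + nat N * (φ 1 * (power φ (ℕ.pred N) n * power ψ m N))
  compositionCoefficient-derivative φ ψ zero    n m =
    solve 4 (λ w v c p → con (+ 0) := w :* con (+ 0) :- v :* (c :* con (+ 0)) :+ con (+ 0) :* p)
      refl (nat (suc n)) (nat m) (ψ 1 * φ 1) _
  compositionCoefficient-derivative φ ψ (suc N) n m =
    trans (+-congʳ (compositionCoefficient-derivative φ ψ N n m))
      (solve 13 (λ w v d c e₁ e₂ N p y p⁺ p₀ y⁺ y⁻ →
          (w :* e₁ :- v :* (d :* c :* e₂) :+ N :* (c :* (p :* y)))
            :+ ((w :* p⁺ :- N :* (c :* p)) :* y
                :+ p₀ :* (((con (+ 1) :+ N) :* y⁺ :- v :* (d :* y⁻)) :* c))
          := w :* (e₁ :+ p⁺ :* y) :- v :* (d :* c :* (e₂ :+ p₀ :* y⁻))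
               :+ (con (+ 1) :+ N) :* (c :* (p₀ :* y⁺)))
        refl (nat (suc n)) (nat m) (ψ 1) (φ 1)
        (compositionCoefficient φ ψ N (suc n) m) (compositionCoefficient φ ψ N n (ℕ.pred m)) (nat N)
        (power φ (ℕ.pred N) n) (power ψ m N) (power φ N (suc n)) (power φ N n)
        (power ψ m (suc N)) (power ψ (ℕ.pred m) N))

  -- The Kronecker delta.

  δ : ℕ → ℕ → Carrier
  δ zero    zero    = 1#
  δ zero    (suc m) = 0#
  δ (suc n) zero    = 0#
  δ (suc n) (suc m) = δ n m

  δ-refl : ∀ n → δ n n ≡ 1#
  δ-refl zero    = ≡.refl
  δ-refl (suc n) = δ-refl n

  δ-< : ∀ {m n} → m ℕ.< n → δ n m ≡ 0#
  δ-< {zero}  (s≤s _)   = ≡.refl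
  δ-< {suc m} (s≤s m<n) = δ-< m<n

  δ-exchange : ∀ n m → nat n * δ n m ≈ nat m * δ n m
  δ-exchange zero    zero    = refl
  δ-exchange zero    (suc m) = trans (zeroˡ _) (sym (zeroʳ _))
  δ-exchange (suc n) zero    = trans (zeroʳ _) (sym (zeroˡ _))
  δ-exchange (suc n) (suc m) = begin
    (1# + nat n) * δ n m   ≈⟨ distribʳ _ _ _ ⟩
    1# * δ n m + nat n * δ n m ≈⟨ +-congˡ (δ-exchange n m) ⟩
    1# * δ n m + nat m * δ n m ≈⟨ distribʳ _ _ _ ⟨
    (1# + nat m) * δ n m   ∎

  -- The identity matrix satisfies the recurrence (n + 1) E(n + 1, m) = m E(n, m - 1) that the
  -- vanishing derivative gives for E.
  δ-suc : ∀ n m → nat (suc n) * δ (suc n) m ≈ nat m * δ n (ℕ.pred m)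
  δ-suc n zero    = trans (zeroʳ _) (sym (zeroˡ _))
  δ-suc n (suc m) = δ-exchange (suc n) (suc m)

  -- Base case of the induction on n: of the powers of φ only φ⁰ has a constant term.
  compositionCoefficient-zero : ∀ φ ψ → φ 0 ≈ 0# → ψ 0 ≈ 0# → ∀ N m →
    compositionCoefficient φ ψ (suc N) 0 m ≈ δ 0 m
  compositionCoefficient-zero φ ψ φ₀ ψ₀ N m = begin
    sum (suc N) t                 ≈⟨ sum-suc N t ⟩
    t 0 + sum N (t ∘ suc)         ≈⟨ +-cong (*-identityˡ _) (sum-zero N (λ k _ →
      trans (*-congʳ (power-vanish φ₀ (suc k) 0 (s≤s z≤n))) (zeroˡ _))) ⟩
    power ψ m 0 + 0#              ≈⟨ +-identityʳ _ ⟩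
    power ψ m 0                   ≈⟨ constant m ⟩
    δ 0 m                         ∎
    where
    t : Series
    t k = power φ k 0 * power ψ m k

    constant : ∀ m → power ψ m 0 ≈ δ 0 m
    constant zero    = refl
    constant (suc m) = power-vanish ψ₀ (suc m) 0 (s≤s z≤n)

module Analysis {c ℓ₁ ℓ₂} (ℝ : RealNumbers c ℓ₁ ℓ₂) where
  open RealNumbers ℝ hiding (zero)
  open CommutativeRing commutativeRing using (ring)
  open Calculus ℝ
  open PowerSeries commutativeRing
  open IntegerCoefficients commutativeRing using (solve; _:=_; _:+_; _:*_; _:-_; :-_; con)
  open IsStrictPartialOrder isStrictPartialOrder
    using (<-respˡ-≈; <-respʳ-≈) renaming (irrefl to <-irrefl; trans to <-trans)
  open import Algebra.Apartness.Properties.HeytingCommutativeRing heytingCommutativeRing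
    using (invertibleˡ⇒#; x-0≈x)
  open AddExtrema _<_ using (_<±_; <±-trans; [_]<⊤±) renaming ([_] to [_]±)
  open import Algebra.Properties.Ring ring using (-‿involutive)
    renaming (x∙y⁻¹≈ε⇒x≈y to x-y≈0⇒x≈y)
  open import Algebra.Properties.Semiring.Mult (CommutativeRing.semiring commutativeRing) using (×1-homo-*)
  open import Relation.Binary.Reasoning.Setoid setoid

  -- Ordered field arithmetic.

  <⇒0<- : ∀ {a b} → a < b → 0# < b - a
  <⇒0<- {a} a<b = <-respˡ-≈ (-‿inverseʳ a) (+-monoˡ-< (- a) a<b)

  -- Taking `p ≈ b - a` as an argument reduces a strict inequality to a visibly positive expression
  -- and an identity for the solver.
  0<-⇒< : ∀ {a b p} → 0# < p → p ≈ b - a → a < b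
  0<-⇒< {a} {b} 0<p p≈b-a = <-respʳ-≈ (trans (+-congʳ p≈b-a)
      (solve 2 (λ a b → (b :- a) :+ a := b) refl a b))
    (<-respˡ-≈ (+-identityˡ a) (+-monoˡ-< a 0<p))

  +-mono-< : ∀ {a b c d} → a < b → c < d → a + c < b + d
  +-mono-< {a} {b} {c} {d} a<b c<d = <-trans (+-monoˡ-< c a<b)
    (<-respʳ-≈ (+-comm d b) (<-respˡ-≈ (+-comm c b) (+-monoˡ-< b c<d)))

  +-positive : ∀ {a b} → 0# < a → 0# < b → 0# < a + b
  +-positive 0<a 0<b = <-respˡ-≈ (+-identityˡ 0#) (+-mono-< 0<a 0<b)

  neg-< : ∀ {a b} → a < b → - b < - a
  neg-< {a} {b} a<b = 0<-⇒< (<⇒0<- a<b) (solve 2 (λ a b → b :- a := :- a :- (:- b)) refl a b)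

  *-monoʳ-< : ∀ {a b k} → 0# < k → a < b → a * k < b * k
  *-monoʳ-< {a} {b} {k} 0<k a<b = 0<-⇒< (*-positive (<⇒0<- a<b) 0<k)
    (solve 3 (λ a b k → (b :- a) :* k := b :* k :- a :* k) refl a b k)

  <⇒# : ∀ {a b} → a < b → a # b
  <⇒# a<b = Equivalence.from #⇔<⊎> (inj₁ a<b)

  ⁻¹-inverse : ∀ {a} (a#0 : a # 0#) → a * a ⁻¹⟨ a#0 ⟩ ≈ 1#
  ⁻¹-inverse {a} a#0 = trans (*-congʳ (sym (x-0≈x a))) (proj₂ (proj₂ (#⇒invertible a#0)))

  -- Apartness from 0 is obtained by exhibiting an inverse; the denominators of both recurrences are
  -- justified in this way.
  inverse⇒# : ∀ {a b} → a * b ≈ 1# → a # 0#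
  inverse⇒# {a} {b} ab≈1 = invertibleˡ⇒# (b , trans (*-congˡ (x-0≈x a)) (trans (*-comm b a) ab≈1))

  inverse-unique : ∀ {a b} (a#0 : a # 0#) → a * b ≈ 1# → b ≈ a ⁻¹⟨ a#0 ⟩
  inverse-unique {a} {b} a#0 ab≈1 = begin
    b               ≈⟨ *-identityʳ b ⟨
    b * 1#          ≈⟨ *-congˡ (⁻¹-inverse a#0) ⟨
    b * (a * a⁻¹)   ≈⟨ solve 3 (λ a b i → b :* (a :* i) := (a :* b) :* i) refl a b a⁻¹ ⟩
    (a * b) * a⁻¹   ≈⟨ *-congʳ ab≈1 ⟩
    1# * a⁻¹        ≈⟨ *-identityˡ a⁻¹ ⟩
    a⁻¹             ∎
    where a⁻¹ = a ⁻¹⟨ a#0 ⟩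

  *-cancelʳ : ∀ {a b k} → k # 0# → a * k ≈ b * k → a ≈ b
  *-cancelʳ {a} {b} {k} k#0 e = begin
    a               ≈⟨ expand a ⟩
    (a * k) * k⁻¹   ≈⟨ *-congʳ e ⟩
    (b * k) * k⁻¹   ≈⟨ expand b ⟨
    b               ∎
    where
    k⁻¹ = k ⁻¹⟨ k#0 ⟩

    expand : ∀ x → x ≈ (x * k) * k⁻¹
    expand x = trans (sym (*-identityʳ x)) (trans (*-congˡ (sym (⁻¹-inverse k#0))) (sym (*-assoc _ _ _)))

  solve-linear : ∀ {a b s} (a#0 : a # 0#) → a * b + s ≈ 0# → b ≈ - a ⁻¹⟨ a#0 ⟩ * s
  solve-linear {a} {b} {s} a#0 e = begin
    b                             ≈⟨ *-identityʳ b ⟨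
    b * 1#                        ≈⟨ *-congˡ (⁻¹-inverse a#0) ⟨
    b * (a * a⁻¹)
      ≈⟨ solve 4 (λ a b s i → b :* (a :* i) := (a :* b :+ s) :* i :+ (:- i) :* s) refl a b s a⁻¹ ⟩
    (a * b + s) * a⁻¹ + - a⁻¹ * s ≈⟨ +-congʳ (*-congʳ e) ⟩
    0# * a⁻¹ + - a⁻¹ * s          ≈⟨ +-congʳ (zeroˡ a⁻¹) ⟩
    0# + - a⁻¹ * s                ≈⟨ +-identityˡ _ ⟩
    - a⁻¹ * s                     ∎
    where a⁻¹ = a ⁻¹⟨ a#0 ⟩

  reciprocal : ∀ {a} → 0# < a → ∃[ w ] 0# < w × a * w ≈ 1#
  reciprocal {a} 0<a = w , positive (Equivalence.to #⇔<⊎> (inverse⇒# (trans (*-comm w a) aw≈1))) , aw≈1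
    where
    a#0 = #-sym (<⇒# 0<a)
    w = a ⁻¹⟨ a#0 ⟩
    aw≈1 = ⁻¹-inverse a#0

    positive : w < 0# ⊎ 0# < w → 0# < w
    positive (inj₂ 0<w) = 0<w
    -- If w < 0 then a (-w) = -1 is positive, and so is 1 - 1 = 0.
    positive (inj₁ w<0) = ⊥-elim (<-irrefl refl (<-respˡ-≈ 1-1≈0 (+-positive 0<1 0<-1)))
      where
      0<-1 : 0# < - 1#
      0<-1 = <-respʳ-≈ (trans (solve 2 (λ a w → a :* (con (+ 0) :- w) := :- (a :* w)) refl a w) (-‿cong aw≈1))
               (*-positive 0<a (<⇒0<- w<0))
      1-1≈0 : 0# ≈ 1# - 1#
      1-1≈0 = sym (-‿inverseʳ 1#)

  half : ∀ {ε} → 0# < ε → ∃[ η ] 0# < η × η + η ≈ ε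
  half {ε} 0<ε with reciprocal (+-positive 0<1 0<1)
  ... | w , 0<w , 2w≈1 = ε * w , *-positive 0<ε 0<w , (begin
    ε * w + ε * w     ≈⟨ solve 2 (λ e w → e :* w :+ e :* w := e :* ((con (+ 1) :+ con (+ 1)) :* w)) refl ε w ⟩
    ε * ((1# + 1#) * w) ≈⟨ *-congˡ 2w≈1 ⟩
    ε * 1#            ≈⟨ *-identityʳ ε ⟩
    ε                 ∎)

  halve-positive : ∀ {d} → 0# < d + d → 0# < d
  halve-positive {d} 0<2d with reciprocal (+-positive 0<1 0<1)
  ... | w , 0<w , 2w≈1 = <-respʳ-≈ (begin
    (d + d) * w        ≈⟨ solve 2 (λ e w → (e :+ e) :* w := e :* ((con (+ 1) :+ con (+ 1)) :* w)) refl d w ⟩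
    d * ((1# + 1#) * w) ≈⟨ *-congˡ 2w≈1 ⟩
    d * 1#            ≈⟨ *-identityʳ d ⟩
    d                 ∎) (*-positive 0<2d 0<w)

  -- The order need not be decidable, so no minimum is chosen by cases. The witness is ab/(a + b),
  -- since a - ab/(a + b) = a²/(a + b), and likewise for b.
  smaller : ∀ {a b} → 0# < a → 0# < b → ∃[ m ] 0# < m × m < a × m < b
  smaller {a} {b} 0<a 0<b with reciprocal (+-positive 0<a 0<b)
  ... | w , 0<w , [a+b]w≈1 =
    a * b * w , *-positive (*-positive 0<a 0<b) 0<w ,
    0<-⇒< (*-positive (*-positive 0<a 0<a) 0<w) (begin
      a * a * w                       ≈⟨ solve 3 (λ a b w → a :* a :* w := a :* ((a :+ b) :* w) :- a :* b :* w) refl a b w ⟩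
      a * ((a + b) * w) - a * b * w   ≈⟨ +-congʳ (trans (*-congˡ [a+b]w≈1) (*-identityʳ a)) ⟩
      a - a * b * w                   ∎) ,
    0<-⇒< (*-positive (*-positive 0<b 0<b) 0<w) (begin
      b * b * w                       ≈⟨ solve 3 (λ a b w → b :* b :* w := b :* ((a :+ b) :* w) :- a :* b :* w) refl a b w ⟩
      b * ((a + b) * w) - a * b * w   ≈⟨ +-congʳ (trans (*-congˡ [a+b]w≈1) (*-identityʳ b)) ⟩
      b - a * b * w                   ∎)

  -- Bounds on absolute values.

  ∣∣<-resp-≈ : ∀ {u v a} → u ≈ v → ∣ u ∣< a → ∣ v ∣< a
  ∣∣<-resp-≈ u≈v (l , r) = <-respʳ-≈ u≈v l , <-respˡ-≈ u≈v r

  ∣∣<-mono : ∀ {u a b} → a < b → ∣ u ∣< a → ∣ u ∣< b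
  ∣∣<-mono a<b (l , r) = <-trans (neg-< a<b) l , <-trans r a<b

  ∣∣<-resp-bound : ∀ {u a b} → a ≈ b → ∣ u ∣< a → ∣ u ∣< b
  ∣∣<-resp-bound a≈b (l , r) = <-respˡ-≈ (-‿cong a≈b) l , <-respʳ-≈ a≈b r

  ∣0∣< : ∀ {a} → 0# < a → ∣ 0# ∣< a
  ∣0∣< {a} 0<a = 0<-⇒< 0<a (solve 1 (λ a → a := con (+ 0) :- (:- a)) refl a) , 0<a

  ∣∣<-+ : ∀ {u v a b} → ∣ u ∣< a → ∣ v ∣< b → ∣ u + v ∣< a + b
  ∣∣<-+ {u} {v} {a} {b} (l , r) (l′ , r′) =
    <-respˡ-≈ (solve 2 (λ a b → :- a :+ :- b := :- (a :+ b)) refl a b) (+-mono-< l l′) , +-mono-< r r′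

  -- 2(ab - uv) = (a - u)(b + v) + (a + u)(b - v), and likewise with v replaced by -v.
  ∣∣<-* : ∀ {u v a b} → ∣ u ∣< a → ∣ v ∣< b → ∣ u * v ∣< a * b
  ∣∣<-* {u} {v} {a} {b} (l , r) (l′ , r′) =
    0<-⇒< (halve-positive (<-respʳ-≈
      (solve 4 (λ a b u v → (a :- u) :* (b :- v) :+ (u :- (:- a)) :* (v :- (:- b)) :=
         (u :* v :- (:- (a :* b))) :+ (u :* v :- (:- (a :* b)))) refl a b u v)
      (+-positive (*-positive (<⇒0<- r) (<⇒0<- r′)) (*-positive (<⇒0<- l) (<⇒0<- l′))))) refl ,
    0<-⇒< (halve-positive (<-respʳ-≈
      (solve 4 (λ a b u v → (a :- u) :* (v :- (:- b)) :+ (u :- (:- a)) :* (b :- v) :=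
         (a :* b :- u :* v) :+ (a :* b :- u :* v)) refl a b u v)
      (+-positive (*-positive (<⇒0<- r) (<⇒0<- l′)) (*-positive (<⇒0<- l) (<⇒0<- r′))))) refl

  -- From u < m and -u < n, the sum (m + 1) + (n + 1) bounds both signs and is positive.
  bounded : ∀ u → ∃[ b ] 0# < b × ∣ u ∣< b
  bounded u with archimedean u | archimedean (- u)
  ... | m , u<m | n , -u<n = b , +-positive (0<fromℕ (suc m)) (0<fromℕ (suc n)) ,
        0<-⇒< (+-positive (+-positive (<⇒0<- -u<n) (0<fromℕ (suc m))) 0<1)
          (solve 3 (λ u m n → ((n :- (:- u)) :+ (con (+ 1) :+ m)) :+ con (+ 1) :=
             u :- (:- ((con (+ 1) :+ m) :+ (con (+ 1) :+ n)))) refl u (fromℕ m) (fromℕ n)) ,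
        0<-⇒< (+-positive (+-positive (<⇒0<- u<m) 0<1) (0<fromℕ (suc n)))
          (solve 3 (λ u m n → ((m :- u) :+ con (+ 1)) :+ (con (+ 1) :+ n) :=
             ((con (+ 1) :+ m) :+ (con (+ 1) :+ n)) :- u) refl u (fromℕ m) (fromℕ n))
    where b = fromℕ (suc m) + fromℕ (suc n)

  -- Limits.

  private variable
    I J : OpenInterval
    p q r : Level

  -- Limits are used only to prove equations, which are stable, so Q is needed only up
  -- to double negation; this permits deciding t # x without excluded middle.
  record Near {I} (x : Point I) (Q : Point I → Set p) : Set (c ⊔ ℓ₂ ⊔ p) where
    constructor within
    field
      radius   : Carrier
      0<radius : 0# < radius
      holds    : ∀ t → ∣ proj₁ t - proj₁ x ∣< radius → ¬ ¬ Q t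

  -- The goal at each t is a double negation, so both hypotheses can be opened one inside the other,
  -- on a radius below both radii.
  Near-zip : {x : Point I} {P : Point I → Set p} {Q : Point I → Set q} {R : Point I → Set r} →
    (∀ t → P t → Q t → R t) → Near x P → Near x Q → Near x R
  Near-zip h (within δ₁ 0<δ₁ near₁) (within δ₂ 0<δ₂ near₂) =
    let δ , 0<δ , δ<δ₁ , δ<δ₂ = smaller 0<δ₁ 0<δ₂ in within δ 0<δ λ t t≈x ¬R →
    near₁ t (∣∣<-mono δ<δ₁ t≈x) λ Pt → near₂ t (∣∣<-mono δ<δ₂ t≈x) λ Qt → ¬R (h t Pt Qt)

  -- The limit of a relation rather than of a function: difference quotients are
  -- defined only at t # x, whereas g t - g x ≈ q * (t - x) is meaningful for all t.
  Tends : Point I → (Point I → Carrier → Set p) → Carrier → Set _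
  Tends x P l = ∀ ε → 0# < ε → Near x (λ t → ∃[ q ] P t q × ∣ q - l ∣< ε)

  Tends-map : {x : Point I} {P : Point I → Carrier → Set p} {Q : Point I → Carrier → Set q} {l : Carrier} →
    (∀ t {q} → P t q → Q t q) → Tends x P l → Tends x Q l
  Tends-map h P→l ε 0<ε =
    let within δ 0<δ near = P→l ε 0<ε in within δ 0<δ λ t t≈x ¬Q →
    near t t≈x λ { (q , Ptq , q≈l) → ¬Q (q , h t Ptq , q≈l) }

  Tends-cong : {x : Point I} {P : Point I → Carrier → Set p} {l l′ : Carrier} →
    l ≈ l′ → Tends x P l → Tends x P l′
  Tends-cong l≈l′ P→l ε 0<ε =
    let within δ 0<δ near = P→l ε 0<ε in within δ 0<δ λ t t≈x ¬P →
    near t t≈x λ { (q , Ptq , q≈l) → ¬P (q , Ptq , ∣∣<-resp-≈ (+-congˡ (-‿cong l≈l′)) q≈l) }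

  Tends-const : {x : Point I} (a : Carrier) → Tends x (λ _ q → q ≈ a) a
  Tends-const a ε 0<ε = within 1# 0<1 λ t _ ¬P →
    ¬P (a , refl , ∣∣<-resp-≈ (sym (-‿inverseʳ a)) (∣0∣< 0<ε))

  Tends-increment : (x : Point I) → Tends x (λ t q → q ≈ proj₁ t - proj₁ x) 0#
  Tends-increment x ε 0<ε = within ε 0<ε λ t t≈x ¬P →
    ¬P (_ , refl , ∣∣<-resp-≈ (sym (x-0≈x _)) t≈x)

  Tends-+ : {x : Point I} {P : Point I → Carrier → Set p} {Q : Point I → Carrier → Set q} {l m : Carrier} →
    Tends x P l → Tends x Q m →
    Tends x (λ t s → ∃[ a ] ∃[ b ] P t a × Q t b × s ≈ a + b) (l + m)
  Tends-+ {l = l} {m} P→l Q→m ε 0<ε = let η , 0<η , η+η≈ε = half 0<ε in Near-zip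
    (λ { t (a , Pta , a≈l) (b , Qtb , b≈m) → a + b , (a , b , Pta , Qtb , refl) ,
       (∣∣<-resp-bound η+η≈ε) (∣∣<-resp-≈
         (solve 4 (λ a b l m → (a :- l) :+ (b :- m) := (a :+ b) :- (l :+ m)) refl a b l m)
         (∣∣<-+ a≈l b≈m)) })
    (P→l η 0<η) (Q→m η 0<η)

  -- With a = l + u and b = m + v one has ab - lm = uv + lv + um.
  ∣∣<-*-difference : ∀ {a b l m K M η} → ∣ l ∣< K → ∣ m ∣< M → ∣ a - l ∣< η → ∣ b - m ∣< η →
    ∣ a * b - l * m ∣< (η * η + K * η + η * M)
  ∣∣<-*-difference {a} {b} {l} {m} l<K m<M a≈l b≈m = ∣∣<-resp-≈
    (solve 4 (λ a b l m → (a :- l) :* (b :- m) :+ l :* (b :- m) :+ (a :- l) :* m := a :* b :- l :* m)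
      refl a b l m)
    (∣∣<-+ (∣∣<-+ (∣∣<-* a≈l b≈m) (∣∣<-* l<K b≈m)) (∣∣<-* a≈l m<M))

  -- Choose η below 1 and below ε/(1 + K + M): then η² + Kη + ηM < η(1 + K + M) < ε.
  *-modulus : ∀ {K M ε} → 0# < K → 0# < M → 0# < ε → ∃[ η ] 0# < η × η * η + K * η + η * M < ε
  *-modulus {K} {M} {ε} 0<K 0<M 0<ε =
    let 0<S = +-positive (+-positive 0<1 0<K) 0<M
        w , 0<w , Sw≈1 = reciprocal 0<S
        η , 0<η , η<1 , η<εw = smaller 0<1 (*-positive 0<ε 0<w)
    in η , 0<η , <-trans
         (<-respʳ-≈ (solve 3 (λ e k m → con (+ 1) :* e :+ (k :* e :+ e :* m) :=
                                e :* (con (+ 1) :+ k :+ m)) refl η K M)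
           (<-respˡ-≈ (sym (+-assoc (η * η) (K * η) (η * M)))
             (+-monoˡ-< (K * η + η * M) (*-monoʳ-< 0<η η<1))))
         (<-respʳ-≈ (trans (solve 3 (λ e w s → e :* w :* s := e :* (s :* w)) refl ε w (1# + K + M))
                      (trans (*-congˡ Sw≈1) (*-identityʳ ε)))
           (*-monoʳ-< 0<S η<εw))

  Tends-* : {x : Point I} {P : Point I → Carrier → Set p} {Q : Point I → Carrier → Set q} {l m : Carrier} →
    Tends x P l → Tends x Q m →
    Tends x (λ t s → ∃[ a ] ∃[ b ] P t a × Q t b × s ≈ a * b) (l * m)
  Tends-* {l = l} {m} P→l Q→m ε 0<ε =
    let K , 0<K , l<K = bounded l
        M , 0<M , m<M = bounded m
        η , 0<η , small = *-modulus 0<K 0<M 0<ε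
    in Near-zip
      (λ { t (a , Pta , a≈l) (b , Qtb , b≈m) → a * b , (a , b , Pta , Qtb , refl) ,
         ∣∣<-mono small (∣∣<-*-difference l<K m<M a≈l b≈m) })
      (P→l η 0<η) (Q→m η 0<η)

  -- Derivatives and their rules.

  DerivativeAt : (x : Point I) → (Point I → Carrier) → Carrier → Set _
  DerivativeAt x g = Tends x (λ t q → g t - g x ≈ q * (proj₁ t - proj₁ x))

  -- Suppose no suitable q exists at t. The difference quotient would be one if t were apart from x,
  -- so t ≈ x by tightness; but then both increments are 0 and q = l is suitable.
  HasDerivativeAt⇒DerivativeAt : (g : RealFunction I) (x : Point I) {l : Carrier} →
    HasDerivativeAt g x l → DerivativeAt x (g ⟨$⟩_) l
  HasDerivativeAt⇒DerivativeAt g x {l} g′ ε 0<ε = within (proj₁ (g′ ε 0<ε)) (proj₁ (proj₂ (g′ ε 0<ε)))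
    λ t t≈x ¬P → ¬P (l , flat t (increment≈0 t t≈x ¬P) , l≈l)
    where
    l≈l : ∣ l - l ∣< ε
    l≈l = ∣∣<-resp-≈ (sym (-‿inverseʳ l)) (∣0∣< 0<ε)

    flat : ∀ t → proj₁ t - proj₁ x ≈ 0# → (g ⟨$⟩ t) - (g ⟨$⟩ x) ≈ l * (proj₁ t - proj₁ x)
    flat t t-x≈0 = begin
      (g ⟨$⟩ t) - (g ⟨$⟩ x)     ≈⟨ +-congʳ (Func.cong g (x-y≈0⇒x≈y _ _ t-x≈0)) ⟩
      (g ⟨$⟩ x) - (g ⟨$⟩ x)     ≈⟨ -‿inverseʳ _ ⟩
      0#                        ≈⟨ zeroʳ l ⟨
      l * 0#                    ≈⟨ *-congˡ t-x≈0 ⟨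
      l * (proj₁ t - proj₁ x)   ∎

    increment≈0 : ∀ t → ∣ proj₁ t - proj₁ x ∣< proj₁ (g′ ε 0<ε) →
      ¬ (∃[ q ] (g ⟨$⟩ t) - (g ⟨$⟩ x) ≈ q * (proj₁ t - proj₁ x) × ∣ q - l ∣< ε) →
      proj₁ t - proj₁ x ≈ 0#
    increment≈0 t t≈x ¬P = proj₁ (tight _ _) λ t-x#0 → ¬P (_ , (begin
      (g ⟨$⟩ t) - (g ⟨$⟩ x)                          ≈⟨ *-identityʳ _ ⟨
      ((g ⟨$⟩ t) - (g ⟨$⟩ x)) * 1#                   ≈⟨ *-congˡ (trans (*-comm _ _) (⁻¹-inverse t-x#0)) ⟨
      ((g ⟨$⟩ t) - (g ⟨$⟩ x)) * ((proj₁ t - proj₁ x) ⁻¹⟨ t-x#0 ⟩ * (proj₁ t - proj₁ x))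
                                                     ≈⟨ *-assoc _ _ _ ⟨
      ((g ⟨$⟩ t) - (g ⟨$⟩ x)) * (proj₁ t - proj₁ x) ⁻¹⟨ t-x#0 ⟩ * (proj₁ t - proj₁ x) ∎) ,
      proj₂ (proj₂ (g′ ε 0<ε)) t t-x#0 t≈x)

  DerivativeAt-cong : {x : Point I} {g h : Point I → Carrier} {l l′ : Carrier} →
    (∀ t → g t ≈ h t) → l ≈ l′ → DerivativeAt x g l → DerivativeAt x h l′
  DerivativeAt-cong {x = x} g≈h l≈l′ g′ = Tends-cong l≈l′
    (Tends-map (λ t e → trans (+-cong (sym (g≈h t)) (-‿cong (sym (g≈h x)))) e) g′)

  derivative-const : (x : Point I) (a : Carrier) → DerivativeAt x (λ _ → a) 0#
  derivative-const x a = Tends-map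
    (λ t q≈0 → trans (-‿inverseʳ a) (sym (trans (*-congʳ q≈0) (zeroˡ _)))) (Tends-const 0#)

  derivative-id : (x : Point I) → DerivativeAt x proj₁ 1#
  derivative-id x = Tends-map (λ t q≈1 → sym (trans (*-congʳ q≈1) (*-identityˡ _))) (Tends-const 1#)

  derivative-+ : {x : Point I} {g h : Point I → Carrier} {l m : Carrier} →
    DerivativeAt x g l → DerivativeAt x h m → DerivativeAt x (λ t → g t + h t) (l + m)
  derivative-+ {x = x} {g} {h} g′ h′ = Tends-map (λ { t {s} (a , b , ea , eb , s≈a+b) → begin
      (g t + h t) - (g x + h x)
        ≈⟨ solve 4 (λ g h a b → (g :+ h) :- (a :+ b) := (g :- a) :+ (h :- b)) refl (g t) (h t) (g x) (h x) ⟩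
      (g t - g x) + (h t - h x)        ≈⟨ +-cong ea eb ⟩
      a * Δ t + b * Δ t                ≈⟨ distribʳ _ _ _ ⟨
      (a + b) * Δ t                    ≈⟨ *-congʳ s≈a+b ⟨
      s * Δ t                          ∎ }) (Tends-+ g′ h′)
    where
    Δ : Point _ → Carrier
    Δ t = proj₁ t - proj₁ x

  -- g(t) = g(x) + q (t - x), where q tends to l and t - x tends to 0.
  continuous : {x : Point I} {g : Point I → Carrier} {l : Carrier} →
    DerivativeAt x g l → Tends x (λ t q → q ≈ g t) (g x)
  continuous {x = x} {g} {l} g′ = Tends-cong
    (trans (+-congˡ (zeroʳ l)) (+-identityʳ (g x)))
    (Tends-map (λ { t {s} (a , b , a≈gx , (c , d , e , d≈Δ , b≈cd) , s≈a+b) → begin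
      s                                 ≈⟨ s≈a+b ⟩
      a + b                             ≈⟨ +-cong a≈gx (trans b≈cd (*-congˡ d≈Δ)) ⟩
      g x + c * (proj₁ t - proj₁ x)     ≈⟨ +-congˡ e ⟨
      g x + (g t - g x)                 ≈⟨ solve 2 (λ a b → a :+ (b :- a) := b) refl (g x) (g t) ⟩
      g t                               ∎ })
      (Tends-+ (Tends-const (g x)) (Tends-* g′ (Tends-increment x))))

  -- From g(t)h(t) - g(x)h(x) = (g(t) - g(x)) h(t) + g(x) (h(t) - h(x)); the factor h(t) is handled
  -- by continuity.
  derivative-* : {x : Point I} {g h : Point I → Carrier} {l m : Carrier} →
    DerivativeAt x g l → DerivativeAt x h m → DerivativeAt x (λ t → g t * h t) (l * h x + g x * m)
  derivative-* {x = x} {g} {h} g′ h′ = Tends-map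
    (λ { t {s} (a , b , (c , d , ec , d≈ht , a≈cd) , (e , k , e≈gx , ek , b≈ek) , s≈a+b) → begin
      g t * h t - g x * h x
        ≈⟨ solve 4 (λ g h a b → g :* h :- a :* b := (g :- a) :* h :+ a :* (h :- b)) refl (g t) (h t) (g x) (h x) ⟩
      (g t - g x) * h t + g x * (h t - h x)  ≈⟨ +-cong (*-congʳ ec) (*-congˡ ek) ⟩
      (c * Δ t) * h t + g x * (k * Δ t)
        ≈⟨ solve 5 (λ c D h g k → (c :* D) :* h :+ g :* (k :* D) := (c :* h :+ g :* k) :* D) refl c (Δ t) (h t) (g x) k ⟩
      (c * h t + g x * k) * Δ t
        ≈⟨ *-congʳ (+-cong (trans a≈cd (*-congˡ d≈ht)) (trans b≈ek (*-congʳ e≈gx))) ⟨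
      (a + b) * Δ t                          ≈⟨ *-congʳ s≈a+b ⟨
      s * Δ t                                ∎ })
    (Tends-+ (Tends-* g′ (continuous h′)) (Tends-* (Tends-const (g x)) h′))
    where
    Δ : Point _ → Carrier
    Δ t = proj₁ t - proj₁ x

  -- Slopes multiply. No division by u(t) - u(x) occurs, so this increment may vanish for t apart
  -- from x.
  derivative-∘ : {x : Point I} (u : Point I → Point J) {h : Point J → Carrier} {l m : Carrier} →
    DerivativeAt (u x) h m → DerivativeAt x (proj₁ ∘ u) l → DerivativeAt x (h ∘ u) (m * l)
  derivative-∘ {x = x} u {h} {l} {m} h′ u′ = Tends-map (λ { t {s} (a , b , ea , eb , s≈ab) → begin
      h (u t) - h (u x)                   ≈⟨ ea ⟩
      a * (proj₁ (u t) - proj₁ (u x))     ≈⟨ *-congˡ eb ⟩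
      a * (b * (proj₁ t - proj₁ x))       ≈⟨ *-assoc _ _ _ ⟨
      a * b * (proj₁ t - proj₁ x)         ≈⟨ *-congʳ s≈ab ⟨
      s * (proj₁ t - proj₁ x)             ∎ }) (Tends-* pullback u′)
    where
    -- Continuity of u brings u(t) into the neighbourhood of u(x) on which the slope of h is
    -- controlled.
    pullback : Tends x (λ t q → h (u t) - h (u x) ≈ q * (proj₁ (u t) - proj₁ (u x))) m
    pullback ε 0<ε =
      let within δ 0<δ near  = h′ ε 0<ε
          within η 0<η near′ = continuous u′ δ 0<δ
      in within η 0<η λ t t≈x ¬P → near′ t t≈x λ { (q , q≈ut , close) →
           near (u t) (∣∣<-resp-≈ (+-congʳ q≈ut) close) ¬P }

  -- Uniqueness of derivatives.

  upperRoom : ∀ {x b} → [ x ]ᵉ <± b → ∃[ ρ ] 0# < ρ × (∀ s → s < ρ → [ x + s ]ᵉ <± b)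
  upperRoom {x} {[ b ]ᵉ} [ x<b ]± = b - x , <⇒0<- x<b , λ s s<b-x →
    [ 0<-⇒< (<⇒0<- s<b-x) (solve 3 (λ b x s → (b :- x) :- s := b :- (x :+ s)) refl b x s) ]±
  upperRoom {x} {⊤±} [ _ ]<⊤± = 1# , 0<1 , λ s _ → [ _ ]<⊤±

  -- Openness of the interval enters here: uniqueness of derivatives needs points of I arbitrarily
  -- close to x and apart from it. Moving to the right leaves only the upper endpoint to respect.
  rightNeighbour : (x : Point I) {δ : Carrier} → 0# < δ → ∃[ t ] ∣ proj₁ {B = _∈ I} t - proj₁ x ∣< δ × proj₁ t # proj₁ x
  rightNeighbour {⦅ a , b ⦆} (x , a<x , x<b) {δ} 0<δ =
    let ρ , 0<ρ , below     = upperRoom x<b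
        s , 0<s , s<δ , s<ρ = smaller 0<δ 0<ρ
        s≈x+s-x             = solve 2 (λ x s → s := (x :+ s) :- x) refl x s
        x<x+s               = 0<-⇒< 0<s s≈x+s-x
        -δ<s                = 0<-⇒< (+-positive 0<δ 0<s) (solve 2 (λ d s → d :+ s := s :- (:- d)) refl δ s)
    in (x + s , <±-trans <-trans a<x [ x<x+s ]± , below s s<ρ) ,
       ∣∣<-resp-≈ s≈x+s-x (-δ<s , s<δ) , #-sym (<⇒# x<x+s)

  -- By tightness it suffices to refute l < m and m < l. At a point apart from x both slopes are the
  -- same q; for η = (m - l)/2 the bounds q - l < η and m - q < η add up to m - l < m - l.
  derivative-unique : {x : Point I} {g : Point I → Carrier} {l m : Carrier} →
    DerivativeAt x g l → DerivativeAt x g m → l ≈ m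
  derivative-unique {x = x} {g} g₁ g₂ = proj₁ (tight _ _) λ l#m → case Equivalence.to #⇔<⊎> l#m of λ
    { (inj₁ l<m) → ordered g₁ g₂ l<m ; (inj₂ m<l) → ordered g₂ g₁ m<l }
    where
    difference#0 : ∀ {s t} → s # t → s - t # 0#
    difference#0 s#t = inverse⇒# (proj₂ (proj₂ (#⇒invertible s#t)))

    ordered : ∀ {l m} → DerivativeAt x g l → DerivativeAt x g m → ¬ (l < m)
    ordered {l} {m} g₁ g₂ l<m =
      let η , 0<η , η+η≈m-l = half (<⇒0<- l<m)
          within δ 0<δ near = Near-zip (λ _ → _,_) (g₁ η 0<η) (g₂ η 0<η)
          t , t≈x , t#x     = rightNeighbour x 0<δ
      in near t t≈x λ { ((a , ea , _ , a-l<η) , (b , eb , -η<b-m , _)) →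
      <-irrefl (begin
        (a - l) + (- (b - m))  ≈⟨ +-congʳ (+-congʳ (*-cancelʳ (difference#0 t#x) (trans (sym ea) eb))) ⟩
        (b - l) + (- (b - m))  ≈⟨ solve 3 (λ b l m → (b :- l) :+ (:- (b :- m)) := m :- l) refl b l m ⟩
        m - l                  ≈⟨ η+η≈m-l ⟨
        η + η                  ∎)
      (+-mono-< a-l<η (<-respʳ-≈ (-‿involutive η) (neg-< -η<b-m))) }

  -- Differentiating series coefficients and finite sums.

  derivative-⊛ : {x : Point I} {α β : Point I → Series} {α′ β′ : Series} →
    (∀ i → DerivativeAt x (λ t → α t i) (α′ i)) → (∀ i → DerivativeAt x (λ t → β t i) (β′ i)) →
    ∀ n → DerivativeAt x (λ t → (α t ⊛ β t) n) ((α′ ⊛ β x) n + (α x ⊛ β′) n)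
  derivative-⊛ dα dβ zero    = derivative-* (dα 0) (dβ 0)
  derivative-⊛ dα dβ (suc n) = DerivativeAt-cong (λ _ → refl)
    (solve 4 (λ a b c d → (a :+ b) :+ (c :+ d) := (a :+ c) :+ (b :+ d)) refl _ _ _ _)
    (derivative-+ (derivative-* (dα 0) (dβ (suc n))) (derivative-⊛ (dα ∘ suc) dβ n))

  derivative-sum : {x : Point I} {α : Point I → Series} {α′ : Series} →
    (∀ i → DerivativeAt x (λ t → α t i) (α′ i)) →
    ∀ n → DerivativeAt x (λ t → sum n (α t)) (sum n α′)
  derivative-sum dα zero    = derivative-const _ 0#
  derivative-sum dα (suc n) = derivative-+ (derivative-sum dα n) (dα n)

  -- Taylor coefficients as functions of the base point.

  1/_! : ℕ → Carrier
  1/ n ! = fromℕ (n ℕ.!) ⁻¹⟨ n!#0 n ⟩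

  1/!-suc : ∀ n → 1/ n ! ≈ fromℕ (suc n) * 1/ (suc n) !
  1/!-suc n = sym (inverse-unique (n!#0 n) (begin
    fromℕ (n ℕ.!) * (fromℕ (suc n) * w)   ≈⟨ solve 3 (λ a b w → a :* (b :* w) := b :* a :* w) refl _ _ w ⟩
    fromℕ (suc n) * fromℕ (n ℕ.!) * w     ≈⟨ *-congʳ (×1-homo-* (suc n) (n ℕ.!)) ⟨
    fromℕ (suc n ℕ.!) * w                 ≈⟨ ⁻¹-inverse (n!#0 (suc n)) ⟩
    1#                                    ∎))
    where w = 1/ (suc n) !

  1/0!≈1 : 1/ 0 ! ≈ 1#
  1/0!≈1 = sym (inverse-unique (n!#0 0) (trans (*-identityʳ _) (+-identityʳ 1#)))

  -- The series h(x + z) - h(x) in z. Its constant term is 0 by definition, so `power-vanish`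
  -- applies with `refl`.
  taylor : {h : RealFunction I} → Smooth h → Point I → Series
  taylor h-smooth x zero    = 0#
  taylor h-smooth x (suc l) = (Smooth.deriv h-smooth (suc l) ⟨$⟩ x) * 1/ (suc l) !

  module _ {h : RealFunction I} (h-smooth : Smooth h) (x : Point I) where
    open Smooth h-smooth

    private
      φ : Series
      φ = taylor h-smooth x

    -- The derivative of h⁽ˡ⁾/l! is (l + 1) h⁽ˡ⁺¹⁾/(l + 1)!. At l = 0, where `taylor` has 0 instead
    -- of h, this is the derivative of h itself.
    derivative-coefficient : ∀ l → DerivativeAt x (λ t → (deriv l ⟨$⟩ t) * 1/ l !) (∂ φ l)
    derivative-coefficient l = DerivativeAt-cong (λ _ → refl) (begin
      (deriv (suc l) ⟨$⟩ x) * 1/ l ! + (deriv l ⟨$⟩ x) * 0#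
        ≈⟨ +-cong (*-congˡ (1/!-suc l)) (zeroʳ _) ⟩
      (deriv (suc l) ⟨$⟩ x) * (fromℕ (suc l) * 1/ (suc l) !) + 0#
        ≈⟨ solve 3 (λ d n w → d :* (n :* w) :+ con (+ 0) := n :* (d :* w)) refl _ (fromℕ (suc l)) _ ⟩
      ∂ φ l ∎)
      (derivative-* (HasDerivativeAt⇒DerivativeAt (deriv l) x (deriv-suc l x)) (derivative-const x (1/ l !)))

    derivative-function : DerivativeAt x (h ⟨$⟩_) (φ 1)
    derivative-function = DerivativeAt-cong
      (λ t → trans (*-congˡ 1/0!≈1) (trans (*-identityʳ _) (deriv-zero t)))
      (trans (*-congʳ (+-identityʳ 1#)) (*-identityˡ _))
      (derivative-coefficient 0)

    -- The correction by `φ 1` sits in degree 0 only and accounts for the subtracted constant term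
    -- h(x).
    derivative-taylor : ∀ l → DerivativeAt x (λ t → taylor h-smooth t l) (∂ φ l - φ 1 * 𝟏 l)
    derivative-taylor zero    = DerivativeAt-cong (λ _ → refl)
      (solve 1 (λ a → con (+ 0) := (con (+ 1) :+ con (+ 0)) :* a :- a :* con (+ 1)) refl (φ 1))
      (derivative-const x 0#)
    derivative-taylor (suc l) = DerivativeAt-cong (λ _ → refl)
      (solve 2 (λ a b → a := a :- b :* con (+ 0)) refl (∂ φ (suc l)) (φ 1))
      (derivative-coefficient (suc l))

    derivative-power : ∀ k n → DerivativeAt x (λ t → power (taylor h-smooth t) k n) (shiftDerivative φ k n)
    derivative-power zero    n = DerivativeAt-cong (λ _ → refl) (shiftDerivative-base φ n)
      (derivative-const x (𝟏 n))
    derivative-power (suc k) n = DerivativeAt-cong (λ _ → refl) (shiftDerivative-step φ k n)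
      (derivative-⊛ derivative-taylor (derivative-power k) n)

  -- Compositas as coefficients of powers.

  ∑-cong : ∀ {a} {A : Set a} (xs : List A) {t t′ : A → Carrier} → (∀ i → t i ≈ t′ i) → ∑ xs t ≈ ∑ xs t′
  ∑-cong []       e = refl
  ∑-cong (x ∷ xs) e = +-cong (e x) (∑-cong xs e)

  ∑-++ : ∀ {a} {A : Set a} (xs ys : List A) (t : A → Carrier) → ∑ (xs ++ ys) t ≈ ∑ xs t + ∑ ys t
  ∑-++ []       ys t = sym (+-identityˡ _)
  ∑-++ (x ∷ xs) ys t = trans (+-congˡ (∑-++ xs ys t)) (sym (+-assoc _ _ _))

  ∑-concatMap : ∀ {a b} {A : Set a} {B : Set b} (g : A → List B) (xs : List A) (t : B → Carrier) →
    ∑ (concatMap g xs) t ≈ ∑ xs (λ x → ∑ (g x) t)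
  ∑-concatMap g []       t = refl
  ∑-concatMap g (x ∷ xs) t = trans (∑-++ (g x) (concatMap g xs) t) (+-congˡ (∑-concatMap g xs t))

  ∑-map-∷ : ∀ {k} (l : ℕ) (xs : List (Vec ℕ k)) (t : ℕ → Carrier) →
    ∑ (List.map (l ∷_) xs) (λ λs → ∏ λs t) ≈ t l * ∑ xs (λ λs → ∏ λs t)
  ∑-map-∷ l []       t = sym (zeroʳ _)
  ∑-map-∷ l (x ∷ xs) t = trans (+-congˡ (∑-map-∷ l xs t)) (sym (distribˡ _ _ _))

  ∑-applyUpTo : ∀ {a} {A : Set a} (g : ℕ → A) (t : A → Carrier) n → ∑ (applyUpTo g n) t ≈ sum n (t ∘ g)
  ∑-applyUpTo g t zero    = refl
  ∑-applyUpTo g t (suc n) = trans (+-congˡ (∑-applyUpTo (g ∘ suc) t n)) (sym (sum-suc n (t ∘ g)))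

  -- The clauses of `compositions` split on n first, so the last one computes only once n is a
  -- constructor.
  compositions-suc : ∀ n k →
    compositions n (suc k) ≡ concatMap (λ l → List.map (l ∷_) (compositions (n ℕ.∸ l) k)) (1 ⋯ n)
  compositions-suc zero    k = ≡.refl
  compositions-suc (suc n) k = ≡.refl

  -- Splitting off the first part of a composition matches splitting off one factor of φᵏ⁺¹.
  composita≈power : {h : RealFunction I} (h-smooth : Smooth h) (x : Point I) →
    ∀ n k → composita h-smooth n k x ≈ power (taylor h-smooth x) k n
  composita≈power h-smooth x zero    zero    = +-identityʳ 1#
  composita≈power h-smooth x (suc n) zero    = refl
  composita≈power h-smooth x n       (suc k) = begin
    ∑ (compositions n (suc k)) (λ λs → ∏ λs a)
      ≡⟨ ≡.cong (λ xs → ∑ xs (λ λs → ∏ λs a)) (compositions-suc n k) ⟩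
    ∑ (concatMap (λ l → List.map (l ∷_) (compositions (n ℕ.∸ l) k)) (1 ⋯ n)) (λ λs → ∏ λs a)
      ≈⟨ ∑-concatMap _ (1 ⋯ n) _ ⟩
    ∑ (1 ⋯ n) (λ l → ∑ (List.map (l ∷_) (compositions (n ℕ.∸ l) k)) (λ λs → ∏ λs a))
      ≈⟨ ∑-cong (1 ⋯ n) (λ l → trans (∑-map-∷ l (compositions (n ℕ.∸ l) k) a)
           (*-congˡ (composita≈power h-smooth x (n ℕ.∸ l) k))) ⟩
    ∑ (1 ⋯ n) (λ l → a l * power φ k (n ℕ.∸ l))
      -- Parts are positive, so `a` occurs only at successors, where it is φ by definition; `a 0` is
      -- h(x)/0!, whereas `φ 0` is 0.
      ≈⟨ ∑-applyUpTo suc (λ l → a l * power φ k (n ℕ.∸ l)) n ⟩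
    sum n (λ i → φ (suc i) * power φ k (n ℕ.∸ suc i))
      ≈⟨ trans (+-congʳ (zeroˡ _)) (+-identityˡ _) ⟨
    φ 0 * power φ k n + sum n (λ i → φ (suc i) * power φ k (n ℕ.∸ suc i))
      ≈⟨ sum-suc n (λ i → φ i * power φ k (n ℕ.∸ i)) ⟨
    sum (suc n) (λ i → φ i * power φ k (n ℕ.∸ i))
      ≈⟨ ⊛-sum φ (power φ k) n ⟨
    power φ (suc k) n ∎
    where
    φ = taylor h-smooth x

    a : ℕ → Carrier
    a l = (Smooth.deriv h-smooth l ⟨$⟩ x) * 1/ l !

  -- Sums over ranges of integers.

  sum-⋯ : ∀ {m n} {t : Series} → m ℕ.≤ n → (∀ k → k ℕ.< m → t k ≈ 0#) → sum (suc n) t ≈ ∑ (m ⋯ n) t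
  sum-⋯ {m} {n} {t} m≤n t≈0 = begin
    sum (suc n) t                            ≡⟨ ≡.cong (λ k → sum k t) (ℕ.m+[n∸m]≡n (ℕ.m≤n⇒m≤1+n m≤n)) ⟨
    sum (m ℕ.+ (suc n ℕ.∸ m)) t              ≈⟨ sum-+ m (suc n ℕ.∸ m) t ⟩
    sum m t + sum (suc n ℕ.∸ m) (t ∘ (m ℕ.+_)) ≈⟨ +-cong (sum-zero m t≈0) (sym (∑-applyUpTo (m ℕ.+_) t (suc n ℕ.∸ m))) ⟩
    0# + ∑ (m ⋯ n) t                         ≈⟨ +-identityˡ _ ⟩
    ∑ (m ⋯ n) t                              ∎

  ⋯-first : ∀ {m n} (t : Series) → m ℕ.≤ n → ∑ (m ⋯ n) t ≈ t m + ∑ (suc m ⋯ n) t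
  ⋯-first {m} {n} t m≤n = begin
    ∑ (m ⋯ n) t                                   ≈⟨ ∑-applyUpTo (m ℕ.+_) t (suc n ℕ.∸ m) ⟩
    sum (suc n ℕ.∸ m) (t ∘ (m ℕ.+_))              ≡⟨ ≡.cong (λ k → sum k (t ∘ (m ℕ.+_))) (ℕ.+-∸-assoc 1 m≤n) ⟩
    sum (suc (n ℕ.∸ m)) (t ∘ (m ℕ.+_))            ≈⟨ sum-suc (n ℕ.∸ m) (t ∘ (m ℕ.+_)) ⟩
    t (m ℕ.+ 0) + sum (n ℕ.∸ m) (λ i → t (m ℕ.+ suc i))
      ≈⟨ +-cong (reflexive (≡.cong t (ℕ.+-identityʳ m)))
                (sum-cong (n ℕ.∸ m) (λ i → reflexive (≡.cong t (ℕ.+-suc m i)))) ⟩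
    t m + sum (n ℕ.∸ m) (t ∘ (suc m ℕ.+_))        ≈⟨ +-congˡ (∑-applyUpTo (suc m ℕ.+_) t (n ℕ.∸ m)) ⟨
    t m + ∑ (suc m ⋯ n) t                         ∎

  ⋯-last : ∀ {m n} (t : Series) → m ℕ.≤ suc n → ∑ (m ⋯ suc n) t ≈ ∑ (m ⋯ n) t + t (suc n)
  ⋯-last {m} {n} t m≤1+n = begin
    ∑ (m ⋯ suc n) t                               ≈⟨ ∑-applyUpTo (m ℕ.+_) t (suc (suc n) ℕ.∸ m) ⟩
    sum (suc (suc n) ℕ.∸ m) (t ∘ (m ℕ.+_))
      ≡⟨ ≡.cong (λ k → sum k (t ∘ (m ℕ.+_))) (ℕ.+-∸-assoc 1 m≤1+n) ⟩
    sum (suc n ℕ.∸ m) (t ∘ (m ℕ.+_)) + t (m ℕ.+ (suc n ℕ.∸ m))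
      ≈⟨ +-cong (sym (∑-applyUpTo (m ℕ.+_) t (suc n ℕ.∸ m))) (reflexive (≡.cong t (ℕ.m+[n∸m]≡n m≤1+n))) ⟩
    ∑ (m ⋯ n) t + t (suc n)                       ∎

  -- Compositas of a function and its left inverse.

  -- The one-sided formulation serves both (f, y) and (y, f). The map `u` is f together with the
  -- proof that its values lie in J, where g and its derivatives are evaluated.
  module LeftInverse {f : RealFunction I} {g : RealFunction J}
    (f-smooth : Smooth f) (g-smooth : Smooth g) (u : Point I → Point J)
    (f≈u : ∀ t → f ⟨$⟩ t ≈ proj₁ (u t)) (g∘u≈id : ∀ t → g ⟨$⟩ u t ≈ proj₁ t) where

    private
      φ ψ : Point I → Series
      φ t = taylor f-smooth t
      ψ t = taylor g-smooth (u t)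

    derivative-u : ∀ x → DerivativeAt x (proj₁ ∘ u) (φ x 1)
    derivative-u x = DerivativeAt-cong f≈u refl (derivative-function f-smooth x)

    -- The chain rule applied to g ∘ u = id.
    inverse-slope : ∀ x → ψ x 1 * φ x 1 ≈ 1#
    inverse-slope x = derivative-unique
      (DerivativeAt-cong g∘u≈id refl (derivative-∘ u (derivative-function g-smooth (u x)) (derivative-u x)))
      (derivative-id x)

    derivative-composition : ∀ x N n m →
      DerivativeAt x (λ t → compositionCoefficient (φ t) (ψ t) N n m)
        (nat (suc n) * compositionCoefficient (φ x) (ψ x) N (suc n) m
          - nat m * (ψ x 1 * φ x 1 * compositionCoefficient (φ x) (ψ x) N n (ℕ.pred m))
          + nat N * (φ x 1 * (power (φ x) (ℕ.pred N) n * power (ψ x) m N)))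
    derivative-composition x N n m = DerivativeAt-cong (λ _ → refl)
      (compositionCoefficient-derivative (φ x) (ψ x) N n m)
      (derivative-sum (λ k → derivative-* (derivative-power f-smooth x k n)
        (derivative-∘ u (derivative-power g-smooth (u x) m k) (derivative-u x))) N)

    -- Induction on n with N fixed, because the derivative formula relates rows n and n + 1 of the
    -- same truncation.
    composition≈δ : ∀ N n m x → n ℕ.< N → compositionCoefficient (φ x) (ψ x) N n m ≈ δ n m
    composition≈δ (suc N) zero    m x _           = compositionCoefficient-zero (φ x) (ψ x) refl refl N m
    composition≈δ (suc N) (suc n) m x (s≤s n<N) = *-cancelʳ (#-sym (<⇒# (0<fromℕ (suc n)))) (begin
      E (suc n) m * nat (suc n)
        ≈⟨ solve 5 (λ e w v d t → e :* w := (w :* e :- v :* d :+ t) :+ v :* d :- t) refl _ (nat (suc n)) (nat m) s b ⟩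
      (nat (suc n) * E (suc n) m - nat m * s + b) + nat m * s - b
        ≈⟨ +-cong (+-cong vanishing (*-congˡ s≈δ)) (-‿cong b≈0) ⟩
      0# + nat m * δ n (ℕ.pred m) - 0#
        ≈⟨ solve 1 (λ a → con (+ 0) :+ a :- con (+ 0) := a) refl _ ⟩
      nat m * δ n (ℕ.pred m)     ≈⟨ δ-suc n m ⟨
      nat (suc n) * δ (suc n) m  ≈⟨ *-comm _ _ ⟩
      δ (suc n) m * nat (suc n)  ∎)
      where
      E : ℕ → ℕ → Carrier
      E = compositionCoefficient (φ x) (ψ x) (suc N)

      s b : Carrier
      s = ψ x 1 * φ x 1 * E n (ℕ.pred m)
      b = nat (suc N) * (φ x 1 * (power (φ x) N n * power (ψ x) m (suc N)))

      s≈δ : s ≈ δ n (ℕ.pred m)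
      s≈δ = trans (*-cong (inverse-slope x) (composition≈δ (suc N) n (ℕ.pred m) x (ℕ.m<n⇒m<1+n n<N)))
        (*-identityˡ _)

      -- The boundary term of the telescoping sum contains the coefficient of zⁿ in φᴺ, and n < N.
      b≈0 : b ≈ 0#
      b≈0 = trans (*-congˡ (*-congˡ (*-congʳ (power-vanish refl N n n<N))))
        (solve 3 (λ v c y → v :* (c :* (con (+ 0) :* y)) := con (+ 0)) refl _ _ _)

      -- The induction hypothesis is used at every t: E(n, m) is constant on I, so its derivative is
      -- 0.
      vanishing : nat (suc n) * E (suc n) m - nat m * s + b ≈ 0#
      vanishing = derivative-unique
        (DerivativeAt-cong (λ t → composition≈δ (suc N) n m t (ℕ.m<n⇒m<1+n n<N)) refl
          (derivative-composition x (suc N) n m))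
        (derivative-const x (δ n m))

    composita-convolution : ∀ {n m} x → m ℕ.≤ n →
      ∑[ k ← m ⋯ n ] composita f-smooth n k x * composita g-smooth k m (u x) ≈ δ n m
    composita-convolution {n} {m} x m≤n = begin
      ∑[ k ← m ⋯ n ] composita f-smooth n k x * composita g-smooth k m (u x)
        ≈⟨ ∑-cong (m ⋯ n) (λ k → *-cong (composita≈power f-smooth x n k) (composita≈power g-smooth (u x) k m)) ⟩
      ∑[ k ← m ⋯ n ] power (φ x) k n * power (ψ x) m k
        -- Terms with k < m vanish because ψᵐ starts in degree m.
        ≈⟨ sum-⋯ m≤n (λ k k<m → trans (*-congˡ (power-vanish refl m k k<m)) (zeroʳ _)) ⟨
      compositionCoefficient (φ x) (ψ x) (suc n) n m
        ≈⟨ composition≈δ (suc n) n m x ℕ.≤-refl ⟩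
      δ n m ∎

    composita-diagonal : ∀ m x → composita f-smooth m m x * composita g-smooth m m (u x) ≈ 1#
    composita-diagonal m x = begin
      t m                       ≈⟨ +-identityʳ (t m) ⟨
      -- The range `suc m ⋯ m` is empty, but its length reduces only to `m ∸ m`.
      t m + 0#                  ≡⟨ ≡.cong (λ k → t m + ∑ (applyUpTo (suc m ℕ.+_) k) t) (ℕ.n∸n≡0 m) ⟨
      t m + ∑ (suc m ⋯ m) t     ≈⟨ ⋯-first t ℕ.≤-refl ⟨
      ∑ (m ⋯ m) t               ≈⟨ composita-convolution {m} x ℕ.≤-refl ⟩
      δ m m                     ≡⟨ δ-refl m ⟩
      1#                        ∎
      where
      t : Series
      t k = composita f-smooth m k x * composita g-smooth k m (u x)

    -- The term k = m of the vanishing convolution is isolated.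
    recurrence-first : ∀ {n m} x (nz : composita g-smooth m m (u x) # 0#) → m ℕ.< n →
      composita f-smooth n m x ≈ - (composita g-smooth m m (u x) ⁻¹⟨ nz ⟩) *
        (∑[ k ← suc m ⋯ n ] composita f-smooth n k x * composita g-smooth k m (u x))
    recurrence-first {n} {m} x nz m<n = solve-linear nz (begin
      composita g-smooth m m (u x) * composita f-smooth n m x + ∑ (suc m ⋯ n) t
                                    ≈⟨ +-congʳ (*-comm _ _) ⟩
      t m + ∑ (suc m ⋯ n) t         ≈⟨ ⋯-first t (ℕ.<⇒≤ m<n) ⟨
      ∑ (m ⋯ n) t                   ≈⟨ composita-convolution x (ℕ.<⇒≤ m<n) ⟩
      δ n m                         ≡⟨ δ-< m<n ⟩
      0#                            ∎)
      where
      t : Series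
      t k = composita f-smooth n k x * composita g-smooth k m (u x)

    recurrence-last : ∀ {n m} x (nz : composita f-smooth n n x # 0#) → m ℕ.< n →
      composita g-smooth n m (u x) ≈ - (composita f-smooth n n x ⁻¹⟨ nz ⟩) *
        (∑[ k ← m ⋯ n ℕ.∸ 1 ] composita f-smooth n k x * composita g-smooth k m (u x))
    -- m < n makes n a successor, so `n ∸ 1` reduces; now the last term of the convolution is
    -- isolated.
    recurrence-last {suc n} {m} x nz m<1+n = solve-linear nz (begin
      t (suc n) + ∑ (m ⋯ n) t       ≈⟨ +-comm _ _ ⟩
      ∑ (m ⋯ n) t + t (suc n)       ≈⟨ ⋯-last t (ℕ.<⇒≤ m<1+n) ⟨
      ∑ (m ⋯ suc n) t               ≈⟨ composita-convolution x (ℕ.<⇒≤ m<1+n) ⟩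
      δ (suc n) m                   ≡⟨ δ-< m<1+n ⟩
      0#                            ∎)
      where
      t : Series
      t k = composita f-smooth (suc n) k x * composita g-smooth k m (u x)

theorem4p1 : ∀ {c ℓ₁ ℓ₂} (ℝ : RealNumbers c ℓ₁ ℓ₂) →
  let open RealNumbers ℝ
      open Calculus ℝ
  in
  (I J : OpenInterval) (f : Inverse (Points I) (Points J))
  (f-smooth : Smooth (forward f)) (y-smooth : Smooth (backward f)) →
  let FΔ = composita f-smooth
      YΔ = composita y-smooth
      f⟨_⟩ = Inverse.to f
      y⟨_⟩ = Inverse.from f
  in
  (n m : ℕ) → 1 ℕ.≤ m → m ℕ.≤ n →
  (∀ (x : Point J) → Σ[ nz ∈ FΔ m m y⟨ x ⟩ # 0# ]
    (n ≡ m → YΔ n m x ≈ FΔ m m y⟨ x ⟩ ⁻¹⟨ nz ⟩) ×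
    (m ℕ.< n → YΔ n m x ≈
      - (FΔ m m y⟨ x ⟩ ⁻¹⟨ nz ⟩) * (∑[ k ← suc m ⋯ n ] YΔ n k x * FΔ k m y⟨ x ⟩)))
  ×
  (∀ (x : Point I) → Σ[ nz ∈ FΔ n n x # 0# ]
    (n ≡ m → YΔ n m f⟨ x ⟩ ≈ FΔ n n x ⁻¹⟨ nz ⟩) ×
    (m ℕ.< n → YΔ n m f⟨ x ⟩ ≈
      - (FΔ n n x ⁻¹⟨ nz ⟩) * (∑[ k ← m ⋯ n ℕ.∸ 1 ] FΔ n k x * YΔ k m f⟨ x ⟩)))
theorem4p1 ℝ I J f f-smooth y-smooth n m 1≤m m≤n =
  -- Part (1) is the product YΔ FΔ solved for its first term, part (2) the product FΔ YΔ solved for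
  -- its last. The diagonal entries of each product give the inverse of the denominator and the case
  -- n = m.
  (λ x →
    let F*Y≈1 = trans (*-comm _ _) (Y.composita-diagonal m x)
        nz    = inverse⇒# F*Y≈1
    in nz , (λ { ≡.refl → inverse-unique nz F*Y≈1 }) , Y.recurrence-first x nz) ,
  (λ x →
    let nz = inverse⇒# (F.composita-diagonal n x)
    in nz , (λ { ≡.refl → inverse-unique nz (F.composita-diagonal n x) }) , F.recurrence-last x nz)
  where
  open RealNumbers ℝ using (refl; trans; *-comm)
  open Analysis ℝ
  module F = LeftInverse f-smooth y-smooth (Inverse.to f) (λ _ → refl) (Inverse.strictlyInverseʳ f)
  module Y = LeftInverse y-smooth f-smooth (Inverse.from f) (λ _ → refl) (Inverse.strictlyInverseˡ f)
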